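{- Let $G$ be a finite simple graph with girth at least five. If $G$ is vertex decomposable, then $\mathrm{Shed}(G)$ is a dominating set of $G$.
   Context: The girth of a graph is the number of vertices of a smallest induced cycle; an acyclic graph has infinite girth. For a graph $G=(V,E)$ and $x\in V$, $G\setminus x$ is the graph obtained by deleting $x$ and its incident edges; $N(x)$ is the set of neighbours of $x$, $N[x]=N(x)\cup\{x\}$, and $G\setminus N[x]$ is obtained by deleting all vertices of $N[x]$ and their incident edges. A graph is well-covered if all its maximal independent sets have the same cardinality. A graph $G$ is vertex decomposable if $G$ is well-covered and either (i) $G$ has no edges (possibly no vertices), or (ii) there is a vertex $x$ such that both $G\setminus x$ and $G\setminus N[x]$ are vertex decomposable. For a vertex decomposable graph $G$, $\mathrm{Shed}(G)$ is the set of vertices $x$ such that $G\setminus x$ and $G\setminus N[x]$ are both vertex decomposable. A set $D\subseteq V$ is dominating if every vertex of $V\setminus D$ is adjacent to a vertex of $D$. -}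

module Defs where

open import Data.Nat using (ℕ)
open import Data.Bool using (Bool; true; false; _∨_)
open import Data.Fin using (Fin; _≟_)
open import Data.Fin.Subset using (Subset; _∈_; _∉_; _⊆_; _─_; _-_; ∣_∣)
open import Data.Vec using (tabulate)
open import Data.Product using (_×_; ∃)
open import Relation.Nullary using (¬_)
open import Relation.Nullary.Decidable using (isYes)
open import Relation.Binary.PropositionalEquality using (_≡_; _≢_)

record Graph (n : ℕ) : Set where
  field
    adj    : Fin n → Fin n → Bool
    sym    : ∀ u v → adj u v ≡ adj v u
    irrefl : ∀ v → adj v v ≡ false

module _ {n : ℕ} (G : Graph n) where
  open Graph G

  _~_ : Fin n → Fin n → Set
  u ~ v = adj u v ≡ true

  NoInducedC3 : Set
  NoInducedC3 = ∀ a b c → ¬ (a ~ b × b ~ c × c ~ a)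

  NoInducedC4 : Set
  NoInducedC4 = ∀ a b c d →
    ¬ (a ≢ b × a ≢ c × a ≢ d × b ≢ c × b ≢ d × c ≢ d ×
       a ~ b × b ~ c × c ~ d × d ~ a × ¬ (a ~ c) × ¬ (b ~ d))

  GirthAtLeast5 : Set
  GirthAtLeast5 = NoInducedC3 × NoInducedC4

  -- Induced subgraphs of G are represented by their vertex sets S.
  -- Closed neighbourhood N[x] in G.
  closedNbhd : Fin n → Subset n
  closedNbhd x = tabulate (λ v → isYes (v ≟ x) ∨ adj x v)

  delete : Subset n → Fin n → Subset n
  delete S x = S - x

  deleteN : Subset n → Fin n → Subset n
  deleteN S x = S ─ closedNbhd x

  Independent : Subset n → Subset n → Set
  Independent S I = I ⊆ S × (∀ u v → u ∈ I → v ∈ I → ¬ (u ~ v))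

  MaximalIndependent : Subset n → Subset n → Set
  MaximalIndependent S I = Independent S I ×
    (∀ J → Independent S J → I ⊆ J → J ⊆ I)

  WellCovered : Subset n → Set
  WellCovered S = ∀ I J → MaximalIndependent S I → MaximalIndependent S J →
    ∣ I ∣ ≡ ∣ J ∣

  NoEdges : Subset n → Set
  NoEdges S = ∀ u v → u ∈ S → v ∈ S → ¬ (u ~ v)

  data VertexDecomposable (S : Subset n) : Set where
    vd-edgeless : WellCovered S → NoEdges S → VertexDecomposable S
    vd-shed     : WellCovered S → (x : Fin n) → x ∈ S →
                  VertexDecomposable (delete S x) →
                  VertexDecomposable (deleteN S x) →
                  VertexDecomposable S

  Shed : Subset n → Fin n → Set
  Shed S x = x ∈ S × VertexDecomposable (delete S x) ×
             VertexDecomposable (deleteN S x)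

  Dominating : Subset n → (Fin n → Set) → Set
  Dominating S D = ∀ v → v ∈ S → ¬ D v → ∃ λ u → D u × u ∈ S × v ~ u

{-# OPTIONS --safe #-}
module Submission where

-- In girth at least five, a vertex decomposable graph splits into isolated vertices, pendant
-- edges and 5-cycles in which only two non-adjacent vertices have outside neighbours.  Every
-- maximal independent set meets these parts in 1, 1 and 2 vertices.  The splitting is built by
-- adding the shedding vertices x back one at a time: since the graph with x is well-covered, a
-- maximal independent set through x must miss exactly one vertex of the expected count over the
-- old parts.  Hence either x attaches to an isolated vertex (a new pendant edge), or x closes two
-- pendant edges to a 5-cycle, and all other parts survive, since each damaged part could be made
-- to lose a further vertex; otherwise one independent choice per part adjacent to x gives
-- a set through x that misses nothing.  Conversely, deleting an isolated vertex, the non-leaf of a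
-- pendant edge, or one of those two vertices of a 5-cycle (or its closed neighbourhood) leaves such a
-- splitting, so these vertices are shedding, and they dominate the graph.

open import Defs
open import Data.Nat using (ℕ; suc; _+_; _≤_; _<_; z≤n; s≤s)
open import Data.Nat.Properties using (≤-refl; ≤-trans; ≤-reflexive; ≤-antisym; +-assoc; +-comm; +-mono-≤; +-monoˡ-≤; +-identityʳ; m≤n+m; <-irrefl; <-≤-trans; module ≤-Reasoning)
open import Data.Bool using (true; if_then_else_; _∨_)
import Data.Bool.Properties as Bool
open import Data.Empty using (⊥-elim)
import Data.Empty as Empty
open import Data.Fin using (Fin; zero; suc; _≟_)
open import Data.Fin.Properties using (any?)
open import Data.Fin.Subset using (Subset; _∈_; _∉_; _⊆_; _∪_; _─_; _-_; ⁅_⁆; ⊤; ⊥; ∣_∣; inside; outside)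
open import Data.Fin.Subset.Properties using (_∈?_; ∉⊥; Empty-unique; ∣⊥∣≡0; x∈⁅x⁆; x∈⁅y⁆⇒x≡y; x∈p∪q⁺; x∈p∪q⁻; p─⊥≡p; p─q⊆p; x∈p∧x∉q⇒x∈p─q; x∈p∧x≢y⇒x∈p-y; x∈p⇒∣p-x∣<∣p∣; p∩q≢∅⇒∣p─q∣<∣p∣; x∈p∩q⁺)
open import Data.List using (List; []; _∷_; _++_; concatMap; filter; map; allFin)
open import Data.List.Membership.Propositional using (find) renaming (_∈_ to _∈ˡ_; _∉_ to _∉ˡ_)
import Data.List.Membership.DecPropositional as DecMembership
open import Data.List.Membership.Propositional.Properties using (∈-allFin; ∈-map⁺; ∈-++⁺ˡ; ∈-++⁺ʳ; ∈-++⁻; ∈-filter⁺; ∈-filter⁻; ∈-∃++)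
open import Data.List.Properties using (filter-++; filter-all; filter-accept; filter-reject; concatMap-++; map-++)
open import Data.List.Relation.Binary.Permutation.Propositional using (_↭_; refl; prep; swap; ↭-sym; ↭-trans; ↭-reflexive; ↭⇒↭ₛ)
open import Data.List.Relation.Binary.Permutation.Propositional.Properties using (∈-resp-↭; All-resp-↭; map⁺; ++⁺; ++⁺ˡ; ++-identityʳ; ++-comm; ∷↭∷ʳ; shift; shifts; filter-↭)
import Data.List.Relation.Binary.Permutation.Setoid.Properties as Permutationₛ
import Data.List.Relation.Unary.All.Properties as All
open import Data.List.Relation.Unary.All using (All; []; _∷_)
import Data.List.Relation.Unary.All as All
open import Data.List.Relation.Unary.AllPairs using (AllPairs; []; _∷_)
import Data.List.Relation.Unary.AllPairs as AllPairs
import Data.List.Relation.Unary.AllPairs.Properties as AllPairs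
open import Data.List.Relation.Unary.Any using (here; there)
import Data.List.Relation.Unary.Any as Any
open import Data.List.Relation.Unary.Unique.Propositional using (Unique)
open import Data.List.Relation.Unary.Unique.Propositional.Properties using (Unique[x∷xs]⇒x∉xs; filter⁺; allFin⁺)
open import Data.Nat.ListAction using (sum)
open import Data.Nat.ListAction.Properties using (sum-↭; sum-++)
open import Data.Product using (_×_; ∃; _,_; proj₁; proj₂)
open import Data.Sum using (_⊎_; inj₁; inj₂; [_,_])
open import Data.Vec using ([]; _∷_; here; there)
open import Data.Vec.Properties using (lookup∘tabulate; lookup⇒[]=; []=⇒lookup)
open import Function using (_∘_; case_of_)
open import Relation.Nullary using (¬_; Dec; yes; no; does)
open import Relation.Nullary.Decidable using (_×-dec_; ¬?; isYes; decidable-stable)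
open import Relation.Binary.PropositionalEquality using (_≡_; _≢_; refl; sym; trans; cong; cong₂; subst; setoid)

pattern at0 = here refl
pattern at1 = there at0
pattern at2 = there at1
pattern at3 = there at2
pattern at4 = there at3

-- Repetition-free lists and pairwise relations

Unique-resp-↭ : ∀ {A : Set} {xs ys : List A} → xs ↭ ys → Unique xs → Unique ys
Unique-resp-↭ σ = Permutationₛ.Unique-resp-↭ (setoid _) (↭⇒↭ₛ σ)

++⁻-Unique : ∀ {A : Set} (xs : List A) {ys} → Unique (xs ++ ys) → Unique ys
++⁻-Unique [] uq = uq
++⁻-Unique (_ ∷ xs) (_ ∷ uq) = ++⁻-Unique xs uq

++⁻-disjoint : ∀ {A : Set} (xs : List A) {ys v} → Unique (xs ++ ys) → v ∈ˡ xs → v ∈ˡ ys → Empty.⊥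
++⁻-disjoint (x ∷ xs) (x≢ ∷ _) (here refl) l = All.lookup x≢ (∈-++⁺ʳ xs l) refl
++⁻-disjoint (x ∷ xs) (_ ∷ uq) (there k) l = ++⁻-disjoint xs uq k l

AllPairs-∈ : ∀ {A : Set} {R : A → A → Set} {xs : List A} {a b} → AllPairs R xs →
  a ∈ˡ xs → b ∈ˡ xs → a ≡ b ⊎ (R a b ⊎ R b a)
AllPairs-∈ _ (here refl) (here refl) = inj₁ refl
AllPairs-∈ (r ∷ _) (here refl) (there j) = inj₂ (inj₁ (All.lookup r j))
AllPairs-∈ (r ∷ _) (there i) (here refl) = inj₂ (inj₂ (All.lookup r i))
AllPairs-∈ (_ ∷ rs) (there i) (there j) = AllPairs-∈ rs i j

-- Cardinalities of subsets as sums of indicators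

∈─⇒∉ : ∀ {n} {p q : Subset n} {v} → v ∈ p ─ q → v ∉ q
∈─⇒∉ {p = _ ∷ _} {inside  ∷ _} {zero}  ()
∈─⇒∉ {p = _ ∷ _} {outside ∷ _} {zero}  _         ()
∈─⇒∉ {p = _ ∷ _} {_ ∷ _}       {suc v} (there m) (there k) = ∈─⇒∉ m k

∈-⇒≢ : ∀ {n} {p : Subset n} {x v} → v ∈ p - x → v ≢ x
∈-⇒≢ {x = x} m refl = ∈─⇒∉ m (x∈⁅x⁆ x)

∣p∣≡1+∣p-x∣ : ∀ {n} {p : Subset n} {x} → x ∈ p → ∣ p ∣ ≡ suc ∣ p - x ∣
∣p∣≡1+∣p-x∣ {p = inside ∷ p} here = cong (suc ∘ ∣_∣) (sym (p─⊥≡p p))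
∣p∣≡1+∣p-x∣ {p = inside ∷ p} (there m) = cong suc (∣p∣≡1+∣p-x∣ m)
∣p∣≡1+∣p-x∣ {p = outside ∷ p} (there m) = ∣p∣≡1+∣p-x∣ m

module _ {n : ℕ} where

  ind : Subset n → Fin n → ℕ
  ind I v = if does (v ∈? I) then 1 else 0

  count : Subset n → List (Fin n) → ℕ
  count I xs = sum (map (ind I) xs)

  ind-∈ : ∀ {I v} → v ∈ I → ind I v ≡ 1
  ind-∈ {I} {v} m with v ∈? I
  ... | yes _ = refl
  ... | no ¬m = ⊥-elim (¬m m)

  ind-∉ : ∀ {I v} → v ∉ I → ind I v ≡ 0
  ind-∉ {I} {v} ¬m with v ∈? I
  ... | yes m = ⊥-elim (¬m m)
  ... | no _ = refl

  ind≤1 : ∀ I v → ind I v ≤ 1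
  ind≤1 I v with v ∈? I
  ... | yes _ = ≤-refl
  ... | no _ = z≤n

  count-++ : ∀ I xs ys → count I (xs ++ ys) ≡ count I xs + count I ys
  count-++ I [] ys = refl
  count-++ I (x ∷ xs) ys =
    trans (cong (ind I x +_) (count-++ I xs ys)) (sym (+-assoc (ind I x) _ _))

  1≤count : ∀ {I v xs} → v ∈ˡ xs → v ∈ I → 1 ≤ count I xs
  1≤count {I} (here refl) v∈I rewrite ind-∈ v∈I = s≤s z≤n
  1≤count {I} {xs = x ∷ _} (there m) v∈I = ≤-trans (1≤count m v∈I) (m≤n+m _ (ind I x))

  2≤count : ∀ {I v w xs} → v ≢ w → v ∈ˡ xs → w ∈ˡ xs → v ∈ I → w ∈ I → 2 ≤ count I xs
  2≤count v≢w (here refl) (here refl) _ _ = ⊥-elim (v≢w refl)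
  2≤count v≢w (here refl) (there j) v∈I w∈I rewrite ind-∈ v∈I = s≤s (1≤count j w∈I)
  2≤count v≢w (there i) (here refl) v∈I w∈I rewrite ind-∈ w∈I = s≤s (1≤count i v∈I)
  2≤count {I} {xs = x ∷ _} v≢w (there i) (there j) v∈I w∈I =
    ≤-trans (2≤count v≢w i j v∈I w∈I) (m≤n+m _ (ind I x))

  ind-delete : ∀ {I x v} → v ≢ x → ind (I - x) v ≡ ind I v
  ind-delete {I} {x} {v} v≢x with v ∈? I
  ... | yes m = ind-∈ (x∈p∧x≢y⇒x∈p-y m v≢x)
  ... | no ¬m = ind-∉ (¬m ∘ p─q⊆p I ⁅ x ⁆)

  count-delete : ∀ {I x} xs → x ∉ˡ xs → count (I - x) xs ≡ count I xs
  count-delete [] _ = refl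
  count-delete (v ∷ xs) x∉ =
    cong₂ _+_ (ind-delete (λ v≡x → x∉ (here (sym v≡x)))) (count-delete xs (x∉ ∘ there))

  -- Only members of `I` contribute, so any repetition-free list that contains `I` computes its
  -- cardinality, whatever other vertices it lists.
  ∣I∣≡count : ∀ {I} xs → Unique xs → (∀ {v} → v ∈ I → v ∈ˡ xs) → ∣ I ∣ ≡ count I xs
  ∣I∣≡count [] _ cov =
    trans (cong ∣_∣ (Empty-unique (λ { (_ , m) → nil (cov m) }))) (∣⊥∣≡0 n)
    where
    nil : ∀ {v : Fin n} → ¬ (v ∈ˡ [])
    nil ()
  ∣I∣≡count {I} (x ∷ xs) uq@(_ ∷ uxs) cov with x ∈? I
  ... | yes x∈I =
    trans (∣p∣≡1+∣p-x∣ x∈I)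
      (cong suc (trans (∣I∣≡count xs uxs cov′) (count-delete xs (Unique[x∷xs]⇒x∉xs uq))))
    where
    cov′ : ∀ {v} → v ∈ I - x → v ∈ˡ xs
    cov′ m with cov (p─q⊆p I ⁅ x ⁆ m)
    ... | here v≡x = ⊥-elim (∈-⇒≢ m v≡x)
    ... | there k = k
  ... | no x∉I = ∣I∣≡count xs uxs cov′
    where
    cov′ : ∀ {v} → v ∈ I → v ∈ˡ xs
    cov′ m with cov m
    ... | here refl = ⊥-elim (x∉I m)
    ... | there k = k

module _ {n : ℕ} (G : Graph n) where

  open Graph G using (adj) renaming (sym to adj-sym; irrefl to adj-irrefl)

  infix 4 _∼_ _≁_ _∼?_

  _∼_ _≁_ : Fin n → Fin n → Set
  _∼_ = _~_ G
  u ≁ v = ¬ (u ∼ v)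

  _∼?_ : ∀ u v → Dec (u ∼ v)
  u ∼? v = adj u v Bool.≟ true

  ∼-sym : ∀ {u v} → u ∼ v → v ∼ u
  ∼-sym {u} {v} e = trans (adj-sym v u) e

  ∼-irrefl : ∀ {v} → v ≁ v
  ∼-irrefl {v} e with trans (sym e) (adj-irrefl v)
  ... | ()

  _∈ˡ?_ : ∀ (v : Fin n) xs → Dec (v ∈ˡ xs)
  _∈ˡ?_ = DecMembership._∈?_ _≟_

  ∼⇒≢ : ∀ {u v} → u ∼ v → u ≢ v
  ∼⇒≢ e refl = ∼-irrefl e

  -- Maximal independent sets

  Stable : Subset n → Set
  Stable I = ∀ {u v} → u ∈ I → v ∈ I → u ≁ v

  -- Maximality is expressed as domination, which can be tested vertex by vertex and hence part by
  -- part. `Mis⇒Maximal` and `Maximal⇒Mis` match it with `MaximalIndependent`.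
  record Mis (S I : Subset n) : Set where
    constructor mis
    field
      sub    : ∀ {v} → v ∈ I → v ∈ S
      stable : Stable I
      dom    : ∀ {v} → v ∈ S → v ∈ I ⊎ ∃ λ u → u ∈ I × v ∼ u

  open Mis

  stable-insert : ∀ {I v} → Stable I → (∀ {u} → u ∈ I → v ≁ u) → Stable (I ∪ ⁅ v ⁆)
  stable-insert {I} {v} st v≁ m k with x∈p∪q⁻ I ⁅ v ⁆ m | x∈p∪q⁻ I ⁅ v ⁆ k
  ... | inj₁ m′ | inj₁ k′ = st m′ k′
  ... | inj₁ m′ | inj₂ k′ rewrite x∈⁅y⁆⇒x≡y v k′ = v≁ m′ ∘ ∼-sym
  ... | inj₂ m′ | inj₁ k′ rewrite x∈⁅y⁆⇒x≡y v m′ = v≁ k′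
  ... | inj₂ m′ | inj₂ k′ rewrite x∈⁅y⁆⇒x≡y v m′ | x∈⁅y⁆⇒x≡y v k′ = ∼-irrefl

  sub-insert : ∀ {S I : Subset n} {v} → (∀ {u} → u ∈ I → u ∈ S) → v ∈ S →
    ∀ {u} → u ∈ I ∪ ⁅ v ⁆ → u ∈ S
  sub-insert {I = I} {v} I⊆S v∈S m with x∈p∪q⁻ I ⁅ v ⁆ m
  ... | inj₁ m′ = I⊆S m′
  ... | inj₂ m′ rewrite x∈⁅y⁆⇒x≡y v m′ = v∈S

  neighbour? : ∀ v (I : Subset n) → Dec (∃ λ u → u ∈ I × v ∼ u)
  neighbour? v I = any? (λ u → (u ∈? I) ×-dec (v ∼? u))

  Mis⇒Maximal : ∀ {S I} → Mis S I → MaximalIndependent G S I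
  Mis⇒Maximal {S} {I} M = (sub M , λ u v → stable M) , maximal
    where
    maximal : ∀ J → Independent G S J → I ⊆ J → J ⊆ I
    maximal J (J⊆S , ind-J) I⊆J {v} v∈J with dom M (J⊆S v∈J)
    ... | inj₁ v∈I = v∈I
    ... | inj₂ (u , u∈I , v∼u) = ⊥-elim (ind-J v u v∈J (I⊆J u∈I) v∼u)

  Maximal⇒Mis : ∀ {S I} → MaximalIndependent G S I → Mis S I
  Maximal⇒Mis {S} {I} ((I⊆S , ind-I) , maximal) = mis I⊆S (λ {u} {v} → ind-I u v) dominated
    where
    dominated : ∀ {v} → v ∈ S → v ∈ I ⊎ ∃ λ u → u ∈ I × v ∼ u
    dominated {v} v∈S with neighbour? v I
    ... | yes p = inj₂ p
    ... | no ¬p = inj₁ (maximal (I ∪ ⁅ v ⁆) (sub-insert I⊆S v∈S , λ _ _ → st) (x∈p∪q⁺ ∘ inj₁) (x∈p∪q⁺ (inj₂ (x∈⁅x⁆ v))))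
      where
      st : Stable (I ∪ ⁅ v ⁆)
      st = stable-insert (λ {u} {v} → ind-I u v) (λ u∈I v∼u → ¬p (_ , u∈I , v∼u))

  -- The last component keeps vertices outside `T` out of the set; the recursion needs it to see
  -- that `v` has no neighbour among the vertices already inserted.
  stableSet : ∀ {S} T → All (_∈ S) T → AllPairs _≁_ T →
    ∃ λ I → (∀ {v} → v ∈ I → v ∈ S) × Stable I × All (_∈ I) T × (∀ {v} → v ∈ I → v ∈ˡ T)
  stableSet [] _ _ = ⊥ , (⊥-elim ∘ ∉⊥) , (⊥-elim ∘ ∉⊥) , [] , (⊥-elim ∘ ∉⊥)
  stableSet (v ∷ T) (v∈S ∷ T⊆S) (v≁T ∷ st) with stableSet T T⊆S st
  ... | I , I⊆S , stI , T⊆I , I⊆T =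
    I ∪ ⁅ v ⁆ , sub-insert I⊆S v∈S , stable-insert stI (λ u∈I → All.lookup v≁T (I⊆T u∈I)) ,
    x∈p∪q⁺ (inj₂ (x∈⁅x⁆ v)) ∷ All.map (x∈p∪q⁺ ∘ inj₁) T⊆I , back
    where
    back : ∀ {u} → u ∈ I ∪ ⁅ v ⁆ → u ∈ˡ v ∷ T
    back m with x∈p∪q⁻ I ⁅ v ⁆ m
    ... | inj₁ m′ = there (I⊆T m′)
    ... | inj₂ m′ = here (x∈⁅y⁆⇒x≡y v m′)

  -- Greedy extension: the vertices of `vs` are visited in turn, and one lying in `S` is inserted
  -- when it has no neighbour in the set built so far.
  saturate : ∀ {S I} → (∀ {v} → v ∈ I → v ∈ S) → Stable I → (vs : List (Fin n)) →
    ∃ λ J → (∀ {v} → v ∈ J → v ∈ S) × Stable J × (∀ {v} → v ∈ I → v ∈ J) ×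
      (∀ {v} → v ∈ˡ vs → v ∈ S → v ∈ J ⊎ ∃ λ u → u ∈ J × v ∼ u)
  saturate {S} {I} I⊆S st [] = I , I⊆S , st , (λ m → m) , λ ()
  saturate {S} {I} I⊆S st (v ∷ vs) with saturate I⊆S st vs
  ... | J , J⊆S , stJ , I⊆J , domJ with neighbour? v J | v ∈? S
  ...   | yes p | _ = J , J⊆S , stJ , I⊆J , λ { (here refl) _ → inj₂ p ; (there k) → domJ k }
  ...   | no _ | no v∉S =
    J , J⊆S , stJ , I⊆J , λ { (here refl) v∈S → ⊥-elim (v∉S v∈S) ; (there k) → domJ k }
  ...   | no ¬p | yes v∈S =
    J ∪ ⁅ v ⁆ , sub-insert J⊆S v∈S , stable-insert stJ (λ u∈J v∼u → ¬p (_ , u∈J , v∼u)) ,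
    grow ∘ I⊆J , domJ′
    where
    grow : ∀ {u} → u ∈ J → u ∈ J ∪ ⁅ v ⁆
    grow = x∈p∪q⁺ ∘ inj₁
    domJ′ : ∀ {w} → w ∈ˡ v ∷ vs → w ∈ S → w ∈ J ∪ ⁅ v ⁆ ⊎ ∃ λ u → u ∈ J ∪ ⁅ v ⁆ × w ∼ u
    domJ′ (here refl) _ = inj₁ (x∈p∪q⁺ (inj₂ (x∈⁅x⁆ v)))
    domJ′ (there k) w∈S with domJ k w∈S
    ... | inj₁ m = inj₁ (grow m)
    ... | inj₂ (u , u∈J , w∼u) = inj₂ (u , grow u∈J , w∼u)

  extend : ∀ {S} T → All (_∈ S) T → AllPairs _≁_ T → ∃ λ I → Mis S I × All (_∈ I) T
  extend T T⊆S st with stableSet T T⊆S st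
  ... | I , I⊆S , stI , T⊆I , _ with saturate I⊆S stI (allFin n)
  ...   | J , J⊆S , stJ , I⊆J , domJ = J , mis J⊆S stJ (domJ (∈-allFin _)) , All.map I⊆J T⊆I

  -- Partitions into isolated vertices, pendant edges and basic 5-cycles

  data Part : Set where
    k1 : Fin n → Part
    k2 : Fin n → Fin n → Part
    c5 : Fin n → Fin n → Fin n → Fin n → Fin n → Part

  verts : Part → List (Fin n)
  verts (k1 v) = v ∷ []
  verts (k2 p q) = p ∷ q ∷ []
  verts (c5 a b c d e) = a ∷ b ∷ c ∷ d ∷ e ∷ []

  -- The number of vertices that every maximal independent set has in a good part, by `count≤weight`
  -- and `weight≤count`.
  weight : Part → ℕ
  weight (k1 _) = 1
  weight (k2 _ _) = 1
  weight (c5 _ _ _ _ _) = 2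

  vertices : List Part → List (Fin n)
  vertices = concatMap verts

  weights : List Part → ℕ
  weights Ps = sum (map weight Ps)

  NbrsIn : Subset n → Fin n → List (Fin n) → Set
  NbrsIn S v xs = ∀ {w} → w ∈ S → v ∼ w → w ∈ˡ xs

  record Cycle (a b c d e : Fin n) : Set where
    constructor cycle
    field
      ab : a ∼ b
      bc : b ∼ c
      cd : c ∼ d
      de : d ∼ e
      ea : e ∼ a

  -- In c5 a b c d e only the two non-adjacent vertices a and c may have neighbours
  -- outside the cycle.
  data Good (S : Subset n) : Part → Set where
    good-k1 : ∀ {v} → NbrsIn S v [] → Good S (k1 v)
    good-k2 : ∀ {p q} → p ∼ q → NbrsIn S p (q ∷ []) → Good S (k2 p q)
    good-c5 : ∀ {a b c d e} → Cycle a b c d e → NbrsIn S b (a ∷ c ∷ []) →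
      NbrsIn S d (c ∷ e ∷ []) → NbrsIn S e (d ∷ a ∷ []) → Good S (c5 a b c d e)

  record Decomposition (S : Subset n) : Set where
    constructor decomposition
    field
      parts  : List Part
      unique : Unique (vertices parts)
      cover  : ∀ {v} → v ∈ S → v ∈ˡ vertices parts
      sound  : ∀ {v} → v ∈ˡ vertices parts → v ∈ S
      good   : All (Good S) parts

  open Decomposition

  rotate : ∀ {a b c d e} → Cycle a b c d e → Cycle b c d e a
  rotate (cycle ab bc cd de ea) = cycle bc cd de ea ab

  -- The symmetry of the 5-cycle that respects the roles in `Good`: it fixes `b` and exchanges `a`
  -- with `c` and `d` with `e`, so cases at `c` or `e` reduce to cases at `a` or `d`.
  reflect : ∀ {a b c d e} → Cycle a b c d e → Cycle c b a e d
  reflect (cycle ab bc cd de ea) =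
    cycle (∼-sym bc) (∼-sym ab) (∼-sym ea) (∼-sym de) (∼-sym cd)

  swap-nbrs : ∀ {S v a b} → NbrsIn S v (a ∷ b ∷ []) → NbrsIn S v (b ∷ a ∷ [])
  swap-nbrs N w∈S v∼w with N w∈S v∼w
  ... | here p = there (here p)
  ... | there (here p) = here p

  reflect-good : ∀ {S a b c d e} → Good S (c5 a b c d e) → Good S (c5 c b a e d)
  reflect-good (good-c5 C Nb Nd Ne) =
    good-c5 (reflect C) (swap-nbrs Nb) (swap-nbrs Ne) (swap-nbrs Nd)

  reflect-↭ : ∀ {a b c d e} → verts (c5 c b a e d) ↭ verts (c5 a b c d e)
  reflect-↭ {a} {b} {c} {d} {e} =
    ↭-trans (swap c b refl) (↭-trans (prep b (swap c a refl))
      (↭-trans (swap b a refl) (prep a (prep b (prep c (swap e d refl))))))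

  -- Upper bounds for stable sets, summed over the parts

  edge-count : ∀ {I u v} → Stable I → u ∼ v → ind I u + ind I v ≤ 1
  edge-count {I} {u} {v} st u∼v with u ∈? I
  ... | no _ = ind≤1 I v
  ... | yes u∈I rewrite ind-∉ {I = I} {v} (λ v∈I → st u∈I v∈I u∼v) = ≤-refl

  nbr-∉ : ∀ {I u v} → Stable I → u ∼ v → u ∈ I → v ∉ I
  nbr-∉ st u∼v u∈I v∈I = st u∈I v∈I u∼v

  -- A stable set has at most one end of an edge. On the 5-cycle, `e ∈ I` excludes `a` and `d` and
  -- leaves the edge `bc`; otherwise the edges `ab` and `cd` cover what remains.
  count≤weight : ∀ {S P I} → Good S P → Stable I → count I (verts P) ≤ weight P
  count≤weight {I = I} (good-k1 {v} _) st rewrite +-identityʳ (ind I v) = ind≤1 I v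
  count≤weight {I = I} (good-k2 {p} {q} p∼q _) st
    rewrite +-identityʳ (ind I q) = edge-count st p∼q
  count≤weight {I = I} (good-c5 {a} {b} {c} {d} {e} (cycle ab bc cd de ea) _ _ _) st
    with e ∈? I
  ... | yes e∈I
    rewrite ind-∉ (nbr-∉ st ea e∈I) | ind-∉ (nbr-∉ st (∼-sym de) e∈I)
      | sym (+-assoc (ind I b) (ind I c) 1) = +-monoˡ-≤ 1 (edge-count st bc)
  ... | no _
    rewrite +-identityʳ (ind I d) | sym (+-assoc (ind I a) (ind I b) (ind I c + ind I d)) =
      +-mono-≤ (edge-count st ab) (edge-count st cd)

  vertices-↭ : ∀ {Ps Qs} → Ps ↭ Qs → vertices Ps ↭ vertices Qs
  vertices-↭ _↭_.refl = _↭_.refl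
  vertices-↭ (prep P σ) = ++⁺ˡ (verts P) (vertices-↭ σ)
  vertices-↭ (swap P Q σ) =
    ↭-trans (shifts (verts P) (verts Q)) (++⁺ˡ (verts Q) (++⁺ˡ (verts P) (vertices-↭ σ)))
  vertices-↭ (_↭_.trans σ τ) = ↭-trans (vertices-↭ σ) (vertices-↭ τ)

  count-↭ : ∀ I {xs ys : List (Fin n)} → xs ↭ ys → count I xs ≡ count I ys
  count-↭ I σ = sum-↭ (map⁺ (ind I) σ)

  counts≤weights : ∀ {I} Ps → All (λ P → count I (verts P) ≤ weight P) Ps →
    count I (vertices Ps) ≤ weights Ps
  counts≤weights [] [] = z≤n
  counts≤weights {I} (P ∷ Ps) (h ∷ hs) rewrite count-++ I (verts P) (vertices Ps) =
    +-mono-≤ h (counts≤weights Ps hs)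

  weights≤counts : ∀ {I} Ps → All (λ P → weight P ≤ count I (verts P)) Ps →
    weights Ps ≤ count I (vertices Ps)
  weights≤counts [] [] = z≤n
  weights≤counts {I} (P ∷ Ps) (h ∷ hs) rewrite count-++ I (verts P) (vertices Ps) =
    +-mono-≤ h (weights≤counts Ps hs)

  -- Building and restricting decompositions

  ∈-vertices : ∀ {v P Ps} → P ∈ˡ Ps → v ∈ˡ verts P → v ∈ˡ vertices Ps
  ∈-vertices (here refl) k = ∈-++⁺ˡ k
  ∈-vertices {Ps = Q ∷ _} (there i) k = ∈-++⁺ʳ (verts Q) (∈-vertices i k)

  ∈-vertices⁻ : ∀ {v} Ps → v ∈ˡ vertices Ps → ∃ λ P → P ∈ˡ Ps × v ∈ˡ verts P
  ∈-vertices⁻ (P ∷ Ps) m with ∈-++⁻ (verts P) m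
  ... | inj₁ k = P , here refl , k
  ... | inj₂ k with ∈-vertices⁻ Ps k
  ...   | Q , i , l = Q , there i , l

  -- The permutation alone yields uniqueness, covering and soundness, so that only the goodness of
  -- the new parts has to be shown.
  insert-decomposition : ∀ {S x} → x ∈ S → (D : Decomposition (S - x)) →
    ∀ Qs → vertices Qs ↭ x ∷ vertices (parts D) → All (Good S) Qs → Decomposition S
  insert-decomposition {S} {x} x∈S D Qs σ gd =
    decomposition Qs (Unique-resp-↭ (↭-sym σ) uq′)
      (λ m → ∈-resp-↭ (↭-sym σ) (cov′ m)) (λ m → snd′ (∈-resp-↭ σ m)) gd
    where
    uq′ : Unique (x ∷ vertices (parts D))
    uq′ = All.tabulate (λ k x≡v → ∈-⇒≢ (sound D k) (sym x≡v)) ∷ unique D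
    cov′ : ∀ {v} → v ∈ S → v ∈ˡ x ∷ vertices (parts D)
    cov′ {v} m with v ≟ x
    ... | yes v≡x = here v≡x
    ... | no v≢x = there (cover D (x∈p∧x≢y⇒x∈p-y m v≢x))
    snd′ : ∀ {v} → v ∈ˡ x ∷ vertices (parts D) → v ∈ S
    snd′ (here refl) = x∈S
    snd′ (there k) = p─q⊆p S ⁅ x ⁆ (sound D k)

  record Restricts (S : Subset n) (xs ys : List (Fin n)) : Set where
    constructor restricts
    field
      perm : ys ↭ filter (_∈? S) xs

  -- What survives of a part in a smaller vertex set need not be one part: a 5-cycle can fall apart
  -- into two pendant edges, and a part can vanish.
  record Refinement (S : Subset n) (P : Part) : Set where
    constructor refinement
    field
      pieces      : List Part
      restriction : Restricts S (verts P) (vertices pieces)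
      pieces-good : All (Good S) pieces

  -- Filtering commutes with concatenation, so refinements of the single parts combine. The
  -- permutation lets the part that needs special treatment come first.
  restrict : ∀ {S S′} → (∀ {v} → v ∈ S′ → v ∈ S) → (D : Decomposition S) →
    ∀ {Ps} → parts D ↭ Ps → All (Refinement S′) Ps → Decomposition S′
  restrict {S} {S′} S′⊆S D {Ps} σ rs with refine Ps rs
    where
    refine : ∀ Ps → All (Refinement S′) Ps →
      ∃ λ Qs → vertices Qs ↭ filter (_∈? S′) (vertices Ps) × All (Good S′) Qs
    refine [] [] = [] , refl , []
    refine (P ∷ Ps) (refinement Qs (restricts τ) gd ∷ rs) with refine Ps rs
    ... | Qs′ , τ′ , gd′ = Qs ++ Qs′ ,
      ↭-trans (↭-reflexive (concatMap-++ verts Qs Qs′))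
        (↭-trans (++⁺ τ τ′) (↭-reflexive (sym (filter-++ (_∈? S′) (verts P) (vertices Ps))))) ,
      All.++⁺ gd gd′
  ... | Qs , τ , gd = decomposition Qs
    (Unique-resp-↭ (↭-sym τ) (filter⁺ (_∈? S′) (Unique-resp-↭ (vertices-↭ σ) (unique D))))
    (λ m → ∈-resp-↭ (↭-sym τ) (∈-filter⁺ (_∈? S′) (∈-resp-↭ (vertices-↭ σ) (cover D (S′⊆S m))) m))
    (λ m → proj₂ (∈-filter⁻ (_∈? S′) {xs = vertices Ps} (∈-resp-↭ τ m)))
    gd

  -- At two different positions of `Ps`, the common vertex would be repeated in the concatenated
  -- list.
  same-part : ∀ {Ps P Q v} → Unique (vertices Ps) → P ∈ˡ Ps → Q ∈ˡ Ps →
    v ∈ˡ verts P → v ∈ˡ verts Q → P ≡ Q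
  same-part uq (here refl) (here refl) _ _ = refl
  same-part {P ∷ Ps} uq (here refl) (there j) k l =
    ⊥-elim (++⁻-disjoint (verts P) uq k (∈-vertices j l))
  same-part {Q ∷ Ps} uq (there i) (here refl) k l =
    ⊥-elim (++⁻-disjoint (verts Q) uq l (∈-vertices i k))
  same-part {R ∷ Ps} uq (there i) (there j) k l = same-part (++⁻-Unique (verts R) uq) i j k l

  extract : ∀ {P : Part} {Ps} → P ∈ˡ Ps → ∃ λ Qs → Ps ↭ P ∷ Qs
  extract i with ∈-∃++ i
  ... | ys , zs , refl = ys ++ zs , shift _ ys zs

  extract₂ : ∀ {P Q : Part} {Ps} → P ≢ Q → P ∈ˡ Ps → Q ∈ˡ Ps → ∃ λ Rs → Ps ↭ P ∷ Q ∷ Rs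
  extract₂ P≢Q i j with extract i
  ... | Qs , σ with ∈-resp-↭ σ j
  ...   | here Q≡P = ⊥-elim (P≢Q (sym Q≡P))
  ...   | there k with extract k
  ...     | Rs , τ = Rs , ↭-trans σ (prep _ τ)

  module _ (g5 : GirthAtLeast5 G) where

    -- Girth at least five, and decompositions give well-covered graphs

    triangle : ∀ {a b c} → a ∼ b → b ∼ c → c ∼ a → Empty.⊥
    triangle ab bc ca = proj₁ g5 _ _ _ (ab , bc , ca)

    -- A chord would create a triangle, so every 4-cycle would be induced.
    square : ∀ {a b c d} → a ∼ b → b ∼ c → c ∼ d → d ∼ a → a ≢ c → b ≢ d → Empty.⊥
    square ab bc cd da a≢c b≢d = proj₂ g5 _ _ _ _
      (∼⇒≢ ab , a≢c , ∼⇒≢ (∼-sym da) , ∼⇒≢ bc , b≢d , ∼⇒≢ cd , ab , bc , cd , da ,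
       (λ ac → triangle ab bc (∼-sym ac)) , (λ bd → triangle bc cd (∼-sym bd)))

    no-chord : ∀ {a b c} → a ∼ b → b ∼ c → a ≁ c
    no-chord ab bc ac = triangle ab bc (∼-sym ac)

    -- If the two coincided, `c`, `d`, `e` would form a triangle. Rotations give the other pairs at
    -- distance two.
    cycle-≢ : ∀ {a b c d e} → Cycle a b c d e → a ≢ c
    cycle-≢ (cycle ab bc cd de ea) refl = triangle cd de ea

    settle : ∀ {S I v a b} → Mis S I → v ∈ S → NbrsIn S v (a ∷ b ∷ []) → b ∉ I → v ∈ I ⊎ a ∈ I
    settle M v∈S N b∉I with dom M v∈S
    ... | inj₁ v∈I = inj₁ v∈I
    ... | inj₂ (u , u∈I , v∼u) with N (sub M u∈I) v∼u
    ...   | at0 = inj₂ u∈I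
    ...   | at1 = ⊥-elim (b∉I u∈I)

    -- Vertices with prescribed neighbours must be dominated from inside the part. On the 5-cycle,
    -- `a ∈ I` rules out `e`, so `d` forces `d` or `c`; `e ∈ I` without `a` makes `b` force `b` or
    -- `c`; with neither, `e` forces `d`, which rules out `c`, and then `b` itself is selected.
    weight≤count : ∀ {S P I} → Good S P → All (_∈ S) (verts P) → Mis S I →
      weight P ≤ count I (verts P)
    weight≤count (good-k1 N) (v∈S ∷ []) M with dom M v∈S
    ... | inj₁ v∈I = 1≤count {xs = _ ∷ []} at0 v∈I
    ... | inj₂ (u , u∈I , v∼u) with N (sub M u∈I) v∼u
    ...   | ()
    weight≤count (good-k2 {p} {q} _ N) (p∈S ∷ _) M with dom M p∈S
    ... | inj₁ p∈I = 1≤count {xs = _ ∷ q ∷ []} at0 p∈I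
    ... | inj₂ (u , u∈I , p∼u) with N (sub M u∈I) p∼u
    ...   | at0 = 1≤count {xs = p ∷ _ ∷ []} at1 u∈I
    weight≤count {I = I} (good-c5 {a} {b} {c} {d} {e} C@(cycle ab bc cd de ea) Nb Nd Ne)
      (a∈S ∷ b∈S ∷ c∈S ∷ d∈S ∷ e∈S ∷ []) M = go (a ∈? I) (e ∈? I)
      where
      both : ∀ {v w} → v ≢ w → v ∈ˡ verts (c5 a b c d e) → w ∈ˡ verts (c5 a b c d e) →
        v ∈ I → w ∈ I → 2 ≤ count I (verts (c5 a b c d e))
      both = 2≤count
      go : Dec (a ∈ I) → Dec (e ∈ I) → 2 ≤ count I (verts (c5 a b c d e))
      go (yes a∈I) _ with settle M d∈S Nd (nbr-∉ (stable M) (∼-sym ea) a∈I)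
      ... | inj₁ d∈I = both (cycle-≢ (rotate (rotate (rotate C))) ∘ sym) at0 at3 a∈I d∈I
      ... | inj₂ c∈I = both (cycle-≢ C) at0 at2 a∈I c∈I
      go (no a∉I) (yes e∈I) with settle M b∈S (swap-nbrs Nb) a∉I
      ... | inj₁ b∈I = both (cycle-≢ (rotate (rotate (rotate (rotate C)))) ∘ sym) at1 at4 b∈I e∈I
      ... | inj₂ c∈I = both (cycle-≢ (rotate (rotate C))) at2 at4 c∈I e∈I
      go (no a∉I) (no e∉I) with settle M e∈S Ne a∉I
      ... | inj₁ e∈I = ⊥-elim (e∉I e∈I)
      ... | inj₂ d∈I with settle M b∈S Nb (nbr-∉ (stable M) (∼-sym cd) d∈I)
      ...   | inj₁ b∈I = both (cycle-≢ (rotate C)) at1 at3 b∈I d∈I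
      ...   | inj₂ a∈I = ⊥-elim (a∉I a∈I)

    parts-in : ∀ {S P} (D : Decomposition S) → P ∈ˡ parts D → All (_∈ S) (verts P)
    parts-in D i = All.tabulate (λ k → sound D (∈-vertices i k))

    mis-size : ∀ {S I} (D : Decomposition S) → Mis S I → ∣ I ∣ ≡ weights (parts D)
    mis-size {S} {I} D M = trans (∣I∣≡count (vertices (parts D)) (unique D) (cover D ∘ sub M))
      (≤-antisym
        (counts≤weights (parts D) (All.map (λ g → count≤weight g (stable M)) (good D)))
        (weights≤counts (parts D)
          (All.tabulate (λ i → weight≤count (All.lookup (good D) i) (parts-in D i) M))))

    decomposition⇒wellCovered : ∀ {S} → Decomposition S → WellCovered G S
    decomposition⇒wellCovered D I J mI mJ =
      trans (mis-size D (Maximal⇒Mis mI)) (sym (mis-size D (Maximal⇒Mis mJ)))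

    -- Decomposable graphs are vertex decomposable

    N[_] : Fin n → Subset n
    N[ u ] = closedNbhd G u

    ∈N[]-self : ∀ u → u ∈ N[ u ]
    ∈N[]-self u = lookup⇒[]= u _ (trans (lookup∘tabulate _ u) eq)
      where
      eq : (isYes (u ≟ u) ∨ adj u u) ≡ true
      eq with u ≟ u
      ... | yes _ = refl
      ... | no ¬p = ⊥-elim (¬p refl)

    ∈N[]-nbr : ∀ {u v} → u ∼ v → v ∈ N[ u ]
    ∈N[]-nbr {u} {v} u∼v = lookup⇒[]= v _
      (trans (lookup∘tabulate _ v) (trans (cong (isYes (v ≟ u) ∨_) u∼v) (Bool.∨-zeroʳ _)))

    ∈N[]⁻ : ∀ {u v} → v ∈ N[ u ] → v ≡ u ⊎ u ∼ v
    ∈N[]⁻ {u} {v} m with trans (sym (lookup∘tabulate _ v)) ([]=⇒lookup m)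
    ... | eq with v ≟ u
    ...   | yes v≡u = inj₁ v≡u
    ...   | no _ = inj₂ eq

    ∉─N : ∀ {S u v} → u ∼ v → v ∉ S ─ N[ u ]
    ∉─N u∼v m = ∈─⇒∉ m (∈N[]-nbr u∼v)

    u∉S─N : ∀ {S u} → u ∉ S ─ N[ u ]
    u∉S─N {u = u} m = ∈─⇒∉ m (∈N[]-self u)

    ∈─N : ∀ {S u v} → v ∈ S → v ≢ u → u ≁ v → v ∈ S ─ N[ u ]
    ∈─N {u = u} {v} v∈S v≢u u≁v = x∈p∧x∉q⇒x∈p─q v∈S out
      where
      out : v ∉ N[ u ]
      out m with ∈N[]⁻ m
      ... | inj₁ v≡u = v≢u v≡u
      ... | inj₂ u∼v = u≁v u∼v

    -- Refining parts after a deletion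

    good-⊆ : ∀ {S S′ P} → (∀ {v} → v ∈ S′ → v ∈ S) → Good S P → Good S′ P
    good-⊆ s (good-k1 N) = good-k1 (N ∘ s)
    good-⊆ s (good-k2 pq N) = good-k2 pq (N ∘ s)
    good-⊆ s (good-c5 C Nb Nd Ne) = good-c5 C (Nb ∘ s) (Nd ∘ s) (Ne ∘ s)

    keep : ∀ {S v} {xs ys : List (Fin n)} → v ∈ S → Restricts S xs ys → Restricts S (v ∷ xs) (v ∷ ys)
    keep {S} {v} {xs} v∈S (restricts σ) =
      restricts (↭-trans (prep v σ) (↭-reflexive (sym (filter-accept (_∈? S) {xs = xs} v∈S))))

    drop : ∀ {S v} {xs ys : List (Fin n)} → v ∉ S → Restricts S xs ys → Restricts S (v ∷ xs) ys
    drop {S} {xs = xs} v∉S (restricts σ) =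
      restricts (↭-trans σ (↭-reflexive (sym (filter-reject (_∈? S) {xs = xs} v∉S))))

    done : ∀ {S} → Restricts S [] []
    done = restricts refl

    permute : ∀ {S} {xs ys zs : List (Fin n)} → zs ↭ ys → Restricts S xs ys → Restricts S xs zs
    permute τ (restricts σ) = restricts (↭-trans τ σ)

    module _ {S S′ : Subset n} (S′⊆S : ∀ {v} → v ∈ S′ → v ∈ S) where

      nbrs-drop : ∀ {v w xs} → NbrsIn S v (w ∷ xs) → w ∉ S′ → NbrsIn S′ v xs
      nbrs-drop N w∉ u∈ v∼u with N (S′⊆S u∈) v∼u
      ... | here refl = ⊥-elim (w∉ u∈)
      ... | there k = k

      refine-all : ∀ {P} → Good S P → All (_∈ S′) (verts P) → Refinement S′ P
      refine-all {P} g h = refinement (P ∷ [])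
        (restricts (↭-trans (++-identityʳ (verts P)) (↭-reflexive (sym (filter-all (_∈? S′) h)))))
        (good-⊆ S′⊆S g ∷ [])

      refine-k2 : ∀ {p q} → Good S (k2 p q) → p ∈ S′ → q ∉ S′ → Refinement S′ (k2 p q)
      refine-k2 (good-k2 _ N) p∈ q∉ =
        refinement (k1 _ ∷ []) (keep p∈ (drop q∉ done)) (good-k1 (nbrs-drop N q∉) ∷ [])

      -- The remaining path `b c d e` splits into the edges `bc` and `de`. Their leaves are `b` and
      -- `e`, which have lost the neighbour `a`; `c` keeps its freedom to have outside neighbours.
      refine-c5-a : ∀ {a b c d e} → Good S (c5 a b c d e) →
        a ∉ S′ → b ∈ S′ → c ∈ S′ → d ∈ S′ → e ∈ S′ → Refinement S′ (c5 a b c d e)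
      refine-c5-a {a} {b} {c} {d} {e} (good-c5 (cycle ab bc cd de ea) Nb Nd Ne) a∉ b∈ c∈ d∈ e∈ =
        refinement (k2 b c ∷ k2 e d ∷ [])
          (permute (prep b (prep c (swap e d refl)))
            (drop a∉ (keep b∈ (keep c∈ (keep d∈ (keep e∈ done))))))
          (good-k2 bc (nbrs-drop Nb a∉) ∷ good-k2 (∼-sym de) (nbrs-drop (swap-nbrs Ne) a∉) ∷ [])

      -- This is the effect of deleting the closed neighbourhood of `a`: only the edge `cd` is left,
      -- with leaf `d`, which has lost its neighbour `e`.
      refine-c5-abe : ∀ {a b c d e} → Good S (c5 a b c d e) →
        a ∉ S′ → b ∉ S′ → c ∈ S′ → d ∈ S′ → e ∉ S′ → Refinement S′ (c5 a b c d e)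
      refine-c5-abe {a} {b} {c} {d} {e} (good-c5 (cycle ab bc cd de ea) Nb Nd Ne) a∉ b∉ c∈ d∈ e∉ =
        refinement (k2 d c ∷ [])
          (permute (swap d c refl) (drop a∉ (drop b∉ (keep c∈ (keep d∈ (drop e∉ done))))))
          (good-k2 (∼-sym cd) (nbrs-drop (swap-nbrs Nd) e∉) ∷ [])

    refine-reflect : ∀ {S a b c d e} → Refinement S (c5 c b a e d) → Refinement S (c5 a b c d e)
    refine-reflect {S} {a} {b} {c} {d} {e} (refinement Qs (restricts σ) g) =
      refinement Qs (restricts (↭-trans σ (filter-↭ (_∈? S) (reflect-↭ {a} {b} {c} {d} {e})))) g

    module _ {S : Subset n} {u : Fin n} (u∈S : u ∈ S) where

      S-u⊆S : ∀ {v} → v ∈ S - u → v ∈ S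
      S-u⊆S = p─q⊆p S ⁅ u ⁆

      S─N⊆S : ∀ {v} → v ∈ S ─ N[ u ] → v ∈ S
      S─N⊆S = p─q⊆p S N[ u ]

      refine-delete : ∀ {P} → Good S P → All (_∈ S) (verts P) → u ∉ˡ verts P → Refinement (S - u) P
      refine-delete g h u∉ = refine-all S-u⊆S g
        (All.tabulate (λ k → x∈p∧x≢y⇒x∈p-y (All.lookup h k) λ { refl → u∉ k }))

      -- u has at most one neighbour on a 5-cycle of the partition, and never one of
      -- the vertices whose neighbourhood is prescribed.
      refine-deleteN : ∀ {P} → Good S P → All (_∈ S) (verts P) → u ∉ˡ verts P →
        Refinement (S ─ N[ u ]) P
      refine-deleteN g@(good-k1 N) (v∈S ∷ []) u∉ = refine-all S─N⊆S g
        (∈─N v∈S (λ { refl → u∉ at0 }) (λ u∼v → nil (N u∈S (∼-sym u∼v))) ∷ [])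
        where
        nil : ¬ (u ∈ˡ [])
        nil ()
      refine-deleteN g@(good-k2 {p} {q} pq N) (p∈S ∷ q∈S ∷ []) u∉ with u ∼? q
      ... | yes u∼q = refine-k2 S─N⊆S g p∈ (∉─N u∼q)
        where
        p∈ : p ∈ S ─ N[ u ]
        p∈ = ∈─N p∈S (λ { refl → u∉ at0 }) (λ u∼p → u∉ (there (N u∈S (∼-sym u∼p))))
      ... | no u≁q = refine-all S─N⊆S g
        (∈─N p∈S (λ { refl → u∉ at0 }) (λ u∼p → u∉ (there (N u∈S (∼-sym u∼p)))) ∷
         ∈─N q∈S (λ { refl → u∉ at1 }) u≁q ∷ [])
      refine-deleteN g@(good-c5 {a} {b} {c} {d} {e} C@(cycle ab bc cd de ea) Nb Nd Ne)
        (a∈S ∷ b∈S ∷ c∈S ∷ d∈S ∷ e∈S ∷ []) u∉ = go (u ∼? a) (u ∼? c)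
        where
        b∈ : b ∈ S ─ N[ u ]
        b∈ = ∈─N b∈S (λ { refl → u∉ at1 }) λ u∼b → case Nb u∈S (∼-sym u∼b) of
          λ { at0 → u∉ at0 ; at1 → u∉ at2 }
        d∈ : d ∈ S ─ N[ u ]
        d∈ = ∈─N d∈S (λ { refl → u∉ at3 }) λ u∼d → case Nd u∈S (∼-sym u∼d) of
          λ { at0 → u∉ at2 ; at1 → u∉ at4 }
        e∈ : e ∈ S ─ N[ u ]
        e∈ = ∈─N e∈S (λ { refl → u∉ at4 }) λ u∼e → case Ne u∈S (∼-sym u∼e) of
          λ { at0 → u∉ at3 ; at1 → u∉ at0 }
        a∈ : u ≁ a → a ∈ S ─ N[ u ]
        a∈ = ∈─N a∈S (λ { refl → u∉ at0 })
        c∈ : u ≁ c → c ∈ S ─ N[ u ]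
        c∈ = ∈─N c∈S (λ { refl → u∉ at2 })
        go : Dec (u ∼ a) → Dec (u ∼ c) → Refinement (S ─ N[ u ]) (c5 a b c d e)
        go (yes u∼a) (yes u∼c) =
          ⊥-elim (square u∼a ab bc (∼-sym u∼c) (λ { refl → u∉ at1 }) (cycle-≢ C))
        go (yes u∼a) (no u≁c) = refine-c5-a S─N⊆S g (∉─N u∼a) b∈ (c∈ u≁c) d∈ e∈
        go (no u≁a) (yes u∼c) =
          refine-reflect (refine-c5-a S─N⊆S (reflect-good g) (∉─N u∼c) b∈ (a∈ u≁a) e∈ d∈)
        go (no u≁a) (no u≁c) = refine-all S─N⊆S g (a∈ u≁a ∷ b∈ ∷ c∈ u≁c ∷ d∈ ∷ e∈ ∷ [])

      -- Parts are disjoint, so `u` lies in no other part, and those are covered by `refine-delete`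
      -- and `refine-deleteN`; only the part of `u` needs refinements of its own.
      delete-part : (D : Decomposition S) → ∀ {P} → P ∈ˡ parts D → u ∈ˡ verts P →
        Refinement (S - u) P → Refinement (S ─ N[ u ]) P →
        Decomposition (S - u) × Decomposition (S ─ N[ u ])
      delete-part D {P} i k r rN with extract i
      ... | Rs , σ =
        restrict S-u⊆S D σ (r ∷ All.tabulate λ j → refine-delete (g j) (h j) (u∉ j)) ,
        restrict S─N⊆S D σ (rN ∷ All.tabulate λ j → refine-deleteN (g j) (h j) (u∉ j))
        where
        back : ∀ {Q} → Q ∈ˡ Rs → Q ∈ˡ parts D
        back j = ∈-resp-↭ (↭-sym σ) (there j)
        g : ∀ {Q} → Q ∈ˡ Rs → Good S Q
        g j = All.lookup (good D) (back j)
        h : ∀ {Q} → Q ∈ˡ Rs → All (_∈ S) (verts Q)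
        h j = parts-in D (back j)
        u∉ : ∀ {Q} → Q ∈ˡ Rs → u ∉ˡ verts Q
        u∉ j l = ++⁻-disjoint (verts P) (Unique-resp-↭ (vertices-↭ σ) (unique D)) k (∈-vertices j l)

    -- Core vertices: they are shedding and they dominate

    core : Part → List (Fin n)
    core (k1 v) = v ∷ []
    core (k2 p q) = q ∷ []
    core (c5 a b c d e) = a ∷ c ∷ []

    core⊆verts : ∀ {P u} → u ∈ˡ core P → u ∈ˡ verts P
    core⊆verts {k1 _} k = k
    core⊆verts {k2 _ _} at0 = at1
    core⊆verts {c5 _ _ _ _ _} at0 = at0
    core⊆verts {c5 _ _ _ _ _} at1 = at2

    refine-core-a : ∀ {S a b c d e} → Good S (c5 a b c d e) → All (_∈ S) (verts (c5 a b c d e)) →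
      Refinement (S - a) (c5 a b c d e) × Refinement (S ─ N[ a ]) (c5 a b c d e)
    refine-core-a {S} {a} g@(good-c5 C@(cycle ab bc cd de ea) _ _ _) (a∈S ∷ b∈S ∷ c∈S ∷ d∈S ∷ e∈S ∷ []) =
      refine-c5-a (S-u⊆S a∈S) g (λ m → ∈-⇒≢ m refl)
        (x∈p∧x≢y⇒x∈p-y b∈S (∼⇒≢ (∼-sym ab))) (x∈p∧x≢y⇒x∈p-y c∈S c≢a)
        (x∈p∧x≢y⇒x∈p-y d∈S d≢a) (x∈p∧x≢y⇒x∈p-y e∈S (∼⇒≢ ea)) ,
      refine-c5-abe (S─N⊆S a∈S) g (u∉S─N {S}) (∉─N {S} ab)
        (∈─N c∈S c≢a (no-chord ab bc)) (∈─N d∈S d≢a (no-chord (∼-sym ea) (∼-sym de)))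
        (∉─N {S} (∼-sym ea))
      where
      c≢a = cycle-≢ C ∘ sym
      d≢a = cycle-≢ (rotate (rotate (rotate C)))

    refine-core : ∀ {S P u} → Good S P → All (_∈ S) (verts P) → u ∈ˡ core P →
      Refinement (S - u) P × Refinement (S ─ N[ u ]) P
    refine-core {S} (good-k1 N) _ at0 =
      refinement [] (drop (λ m → ∈-⇒≢ m refl) done) [] , refinement [] (drop (u∉S─N {S}) done) []
    refine-core {S} g@(good-k2 {p} {q} pq N) (p∈S ∷ q∈S ∷ []) at0 =
      refine-k2 (S-u⊆S q∈S) g (x∈p∧x≢y⇒x∈p-y p∈S (∼⇒≢ pq)) (λ m → ∈-⇒≢ m refl) ,
      refinement [] (drop (∉─N {S} (∼-sym pq)) (drop (u∉S─N {S}) done)) []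
    refine-core g@(good-c5 _ _ _ _) h at0 = refine-core-a g h
    refine-core g@(good-c5 _ _ _ _) h at1
      with refine-core-a (reflect-good g) (All-resp-↭ (↭-sym reflect-↭) h)
    ... | r , rN = refine-reflect r , refine-reflect rN

    delete-core : ∀ {S u P} (D : Decomposition S) → P ∈ˡ parts D → u ∈ˡ core P →
      Decomposition (S - u) × Decomposition (S ─ N[ u ])
    delete-core D i k with refine-core (All.lookup (good D) i) (parts-in D i) k
    ... | r , rN = delete-part (sound D (∈-vertices i (core⊆verts k))) D i (core⊆verts k) r rN

    some-core : ∀ P → ∃ λ u → u ∈ˡ core P
    some-core (k1 v) = v , at0
    some-core (k2 p q) = q , at0
    some-core (c5 a b c d e) = a , at0

    -- Induction on a bound for the cardinality of `S`, which drops under both deletions. Any core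
    -- vertex of the first part serves as shedding vertex.
    decomposition⇒vd : ∀ k {S} → ∣ S ∣ < k → Decomposition S → VertexDecomposable G S
    decomposition⇒vd (suc k) {S} (s≤s ∣S∣≤k) D = go (parts D) refl
      where
      go : ∀ Ps → parts D ≡ Ps → VertexDecomposable G S
      go [] eq = vd-edgeless (decomposition⇒wellCovered D)
        (λ u v u∈S _ _ → nil (subst (λ Ps → u ∈ˡ vertices Ps) eq (cover D u∈S)))
        where
        nil : ∀ {u : Fin n} → ¬ (u ∈ˡ [])
        nil ()
      go (P ∷ Ps) eq with some-core P
      ... | u , k∈ = vd-shed (decomposition⇒wellCovered D) u u∈S
          (decomposition⇒vd k (<-≤-trans (x∈p⇒∣p-x∣<∣p∣ u∈S) ∣S∣≤k) (proj₁ smaller))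
          (decomposition⇒vd k (<-≤-trans ∣S─N∣<∣S∣ ∣S∣≤k) (proj₂ smaller))
        where
        P∈ : P ∈ˡ parts D
        P∈ = subst (P ∈ˡ_) (sym eq) (here refl)
        smaller = delete-core D P∈ k∈
        u∈S : u ∈ S
        u∈S = sound D (∈-vertices P∈ (core⊆verts k∈))
        ∣S─N∣<∣S∣ : ∣ S ─ N[ u ] ∣ < ∣ S ∣
        ∣S─N∣<∣S∣ = p∩q≢∅⇒∣p─q∣<∣p∣ S N[ u ] (u , x∈p∩q⁺ (u∈S , ∈N[]-self u))

    core-shed : ∀ {S u P} (D : Decomposition S) → P ∈ˡ parts D → u ∈ˡ core P → Shed G S u
    core-shed D i k with delete-core D i k
    ... | D₁ , D₂ = sound D (∈-vertices i (core⊆verts k)) ,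
      decomposition⇒vd _ ≤-refl D₁ , decomposition⇒vd _ ≤-refl D₂

    core-dominates : ∀ {S P v} → Good S P → v ∈ˡ verts P → v ∈ˡ core P ⊎ ∃ λ u → u ∈ˡ core P × v ∼ u
    core-dominates (good-k1 _) at0 = inj₁ at0
    core-dominates (good-k2 pq _) at0 = inj₂ (_ , at0 , pq)
    core-dominates (good-k2 _ _) at1 = inj₁ at0
    core-dominates (good-c5 C _ _ _) at0 = inj₁ at0
    core-dominates (good-c5 C _ _ _) at1 = inj₂ (_ , at1 , Cycle.bc C)
    core-dominates (good-c5 C _ _ _) at2 = inj₁ at1
    core-dominates (good-c5 C _ _ _) at3 = inj₂ (_ , at1 , ∼-sym (Cycle.cd C))
    core-dominates (good-c5 C _ _ _) at4 = inj₂ (_ , at0 , Cycle.ea C)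

    shed-dominating : ∀ {S} → Decomposition S → Dominating G S (Shed G S)
    shed-dominating D v v∈S ¬shed with ∈-vertices⁻ (parts D) (cover D v∈S)
    ... | P , i , k with core-dominates (All.lookup (good D) i) k
    ...   | inj₁ c = ⊥-elim (¬shed (core-shed D i c))
    ...   | inj₂ (u , c , v∼u) = u , core-shed D i c , sound D (∈-vertices i (core⊆verts c)) , v∼u

    -- Vertex decomposable graphs are decomposable: adding a vertex x

    module _ {S : Subset n} {x : Fin n} where

      apart : ∀ {v} → v ∈ S - x → x ≢ v
      apart v∈ refl = ∈-⇒≢ v∈ refl

      S-x⊆S : ∀ {v} → v ∈ S - x → v ∈ S
      S-x⊆S = p─q⊆p S ⁅ x ⁆

      -- Restoring `x` can add no neighbour other than `x` itself.
      nbrs-grow : ∀ {v xs} → NbrsIn (S - x) v xs → NbrsIn S v (x ∷ xs)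
      nbrs-grow N {w} w∈S v∼w with w ≟ x
      ... | yes w≡x = here w≡x
      ... | no w≢x = there (N (x∈p∧x≢y⇒x∈p-y w∈S w≢x) v∼w)

      nbrs-lift : ∀ {v xs} → NbrsIn (S - x) v xs → x ≁ v → NbrsIn S v xs
      nbrs-lift N x≁v w∈S v∼w with nbrs-grow N w∈S v∼w
      ... | here refl = ⊥-elim (x≁v (∼-sym v∼w))
      ... | there k = k

      -- Parts damaged by the return of x

      outer? : ∀ v xs → (∃ λ r → r ∈ S × v ∼ r × r ∉ˡ xs) ⊎ NbrsIn S v xs
      outer? v xs with any? (λ r → (r ∈? S) ×-dec (v ∼? r) ×-dec ¬? (r ∈ˡ? xs))
      ... | yes p = inj₁ p
      ... | no ¬p = inj₂ (λ {w} w∈S v∼w →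
        decidable-stable (w ∈ˡ? xs) (λ w∉ → ¬p (w , w∈S , v∼w , w∉)))

      -- In the bad cases `x` meets a vertex that must have no outside neighbour. For edges and
      -- 5-cycles, `r` is recorded as an outside neighbour of an adjacent vertex of the part, which
      -- no relabelling of the part can accommodate.
      data Status : Part → Set where
        ok : ∀ {P} → Good S P → Status P
        bad-k1 : ∀ {z} → x ∼ z → Status (k1 z)
        bad-k2 : ∀ {p q r} → x ∼ p → r ∈ S → q ∼ r → r ∉ˡ p ∷ [] → Status (k2 p q)
        bad-d : ∀ {a b c d e r} → x ∼ d → r ∈ S → c ∼ r → r ∉ˡ b ∷ d ∷ [] → Status (c5 a b c d e)
        bad-b : ∀ {a b c d e r} → x ∼ b → r ∈ S → a ∼ r → r ∉ˡ b ∷ e ∷ [] → Status (c5 a b c d e)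

      -- The part may be relabelled first, because another leaf or another pair of open vertices of
      -- the cycle can make it good in `S`.
      record Classified (P : Part) : Set where
        constructor classified
        field
          form   : Part
          form-↭ : verts form ↭ verts P
          form-good : Good (S - x) form
          status : Status form

      classified-ok : ∀ {P} Q → verts Q ↭ verts P → Good S Q → Classified P
      classified-ok Q σ g = classified Q σ (good-⊆ S-x⊆S g) (ok g)

      -- If neither `a` nor `c` has an outside neighbour, a rotation makes `b` and `d` the two open
      -- vertices; `x` misses `e`, as `x b a e` would be a 4-cycle.
      classify-b : ∀ {a b c d e} → All (_∈ S - x) (verts (c5 a b c d e)) →
        Good (S - x) (c5 a b c d e) → x ∼ b → Classified (c5 a b c d e)
      classify-b {a} {b} {c} {d} {e} (a∈ ∷ _) g@(good-c5 C@(cycle ab bc cd de ea) Nb Nd Ne) xb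
        with outer? a (b ∷ e ∷ [])
      ... | inj₁ (r , r∈S , ar , r∉) = classified _ refl g (bad-b xb r∈S ar r∉)
      ... | inj₂ Na with outer? c (b ∷ d ∷ [])
      ...   | inj₁ (r , r∈S , cr , r∉) =
        classified (c5 c b a e d) reflect-↭ (reflect-good g) (bad-b xb r∈S cr r∉)
      ...   | inj₂ Nc = classified-ok (c5 b c d e a) (↭-sym (∷↭∷ʳ a (b ∷ c ∷ d ∷ e ∷ [])))
        (good-c5 (rotate C) Nc (nbrs-lift Ne x≁e) (swap-nbrs Na))
        where
        x≁e : x ≁ e
        x≁e xe = square xb (∼-sym ab) (∼-sym ea) (∼-sym xe) (apart a∈)
          (cycle-≢ (rotate (rotate (rotate (rotate C)))) ∘ sym)

      -- If `c` has no outside neighbour, `d` and `a` can be the open vertices, since `x` misses `e`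
      -- (triangle) and `b` (4-cycle).
      classify-d : ∀ {a b c d e} → All (_∈ S - x) (verts (c5 a b c d e)) →
        Good (S - x) (c5 a b c d e) → x ∼ d → Classified (c5 a b c d e)
      classify-d {a} {b} {c} {d} {e} (_ ∷ _ ∷ c∈ ∷ _) g@(good-c5 C@(cycle ab bc cd de ea) Nb Nd Ne) xd
        with outer? c (b ∷ d ∷ [])
      ... | inj₁ (r , r∈S , cr , r∉) = classified _ refl g (bad-d xd r∈S cr r∉)
      ... | inj₂ Nc = classified-ok (c5 d e a b c) (++-comm (d ∷ e ∷ []) (a ∷ b ∷ c ∷ []))
        (good-c5 (rotate (rotate (rotate C))) (nbrs-lift Ne (no-chord xd de)) (nbrs-lift Nb x≁b) Nc)
        where
        x≁b : x ≁ b
        x≁b xb = square xd (∼-sym cd) (∼-sym bc) (∼-sym xb) (apart c∈) (cycle-≢ (rotate C) ∘ sym)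

      classify : ∀ {P} → All (_∈ S - x) (verts P) → Good (S - x) P → Classified P
      classify _ g@(good-k1 {v} N) with x ∼? v
      ... | yes xv = classified _ refl g (bad-k1 xv)
      ... | no x≁v = classified-ok _ refl (good-k1 (nbrs-lift N x≁v))
      classify _ g@(good-k2 {p} {q} pq N) with x ∼? p
      ... | no x≁p = classified-ok _ refl (good-k2 pq (nbrs-lift N x≁p))
      ... | yes xp with outer? q (p ∷ [])
      ...   | inj₁ (r , r∈S , qr , r∉) = classified _ refl g (bad-k2 xp r∈S qr r∉)
      ...   | inj₂ Nq = classified-ok (k2 q p) (swap q p refl) (good-k2 (∼-sym pq) Nq)
      classify h g@(good-c5 {a} {b} {c} {d} {e} C Nb Nd Ne) with x ∼? b | x ∼? d | x ∼? e
      ... | yes xb | _ | _ = classify-b h g xb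
      ... | no _ | yes xd | _ = classify-d h g xd
      ... | no _ | no _ | yes xe
        -- Reflection moves `e` to the position of `d`.
        with classify-d (All-resp-↭ (↭-sym reflect-↭) h) (reflect-good g) xe
      ...   | classified Q σ gQ s = classified Q (↭-trans σ reflect-↭) gQ s
      classify h g@(good-c5 {a} {b} {c} {d} {e} C Nb Nd Ne) | no x≁b | no x≁d | no x≁e =
        classified-ok _ refl (good-c5 C (nbrs-lift Nb x≁b) (nbrs-lift Nd x≁d) (nbrs-lift Ne x≁e))

      normalise : Decomposition (S - x) → ∃ λ (D : Decomposition (S - x)) → All Status (parts D)
      normalise D with go (parts D) (λ i → i)
        where
        go : ∀ Ps → (∀ {P} → P ∈ˡ Ps → P ∈ˡ parts D) →
          ∃ λ Qs → vertices Qs ↭ vertices Ps × All (Good (S - x)) Qs × All Status Qs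
        go [] _ = [] , refl , [] , []
        go (P ∷ Ps) ⊆D with go Ps (⊆D ∘ there)
        ... | Qs , σ , gd , ss
          with classify (parts-in D (⊆D (here refl))) (All.lookup (good D) (⊆D (here refl)))
        ...   | classified Q τ g s = Q ∷ Qs , ++⁺ τ σ , g ∷ gd , s ∷ ss
      ... | Qs , σ , gd , ss =
        decomposition Qs (Unique-resp-↭ (↭-sym σ) (unique D)) (∈-resp-↭ (↭-sym σ) ∘ cover D)
          (sound D ∘ ∈-resp-↭ σ) gd , ss

      record Loss (P : Part) : Set where
        constructor loss
        field
          witness : List (Fin n)
          witness⊆S : All (_∈ S) witness
          witness-stable : AllPairs _≁_ (x ∷ witness)
          loses : ∀ {I} → Stable I → x ∈ I → All (_∈ I) witness → count I (verts P) < weight P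

      -- A part that is not good in S can be made to lose a vertex: its bad vertex
      -- is dominated by x and its outer vertex by r.
      good-or-loss : ∀ {P} → All (_∈ S - x) (verts P) → Good (S - x) P → Status P → Good S P ⊎ Loss P
      good-or-loss _ _ (ok g) = inj₁ g
      good-or-loss _ _ (bad-k1 {z} xz) = inj₂ (loss [] [] ([] ∷ []) lose)
        where
        lose : ∀ {I} → Stable I → x ∈ I → All (_∈ I) [] → count I (verts (k1 z)) < 1
        lose {I} st x∈I _ rewrite ind-∉ (nbr-∉ st xz x∈I) = s≤s z≤n
      good-or-loss (p∈ ∷ q∈ ∷ []) (good-k2 pq _) (bad-k2 {p} {q} {r} xp r∈S qr r∉) =
        inj₂ (loss (r ∷ []) (r∈S ∷ []) ((x≁r ∷ []) ∷ [] ∷ []) lose)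
        where
        x≁r : x ≁ r
        x≁r xr = square xp pq qr (∼-sym xr) (apart q∈) (λ p≡r → r∉ (here (sym p≡r)))
        lose : ∀ {I} → Stable I → x ∈ I → All (_∈ I) (r ∷ []) → count I (verts (k2 p q)) < 1
        lose {I} st x∈I (r∈I ∷ [])
          rewrite ind-∉ (nbr-∉ st xp x∈I) | ind-∉ (nbr-∉ st (∼-sym qr) r∈I) = s≤s z≤n
      good-or-loss (a∈ ∷ b∈ ∷ c∈ ∷ d∈ ∷ e∈ ∷ []) (good-c5 C@(cycle ab bc cd de ea) _ _ _)
        (bad-d {a} {b} {c} {d} {e} {r} xd r∈S cr r∉) =
        -- Besides `d` and `c`, excluded by `x` and `r`, the witness `a` excludes `b` and `e`, so
        -- that `a` alone is left.
        inj₂ (loss (r ∷ a ∷ []) (r∈S ∷ S-x⊆S a∈ ∷ []) ((x≁r ∷ x≁a ∷ []) ∷ (r≁a ∷ []) ∷ [] ∷ []) lose)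
        where
        x≁r : x ≁ r
        x≁r xr = square xd (∼-sym cd) cr (∼-sym xr) (apart c∈) (λ d≡r → r∉ (there (here (sym d≡r))))
        x≁a : x ≁ a
        x≁a xa = square xd de ea (∼-sym xa) (apart e∈) (cycle-≢ (rotate (rotate (rotate C))))
        r≁a : r ≁ a
        r≁a ra = square (∼-sym cr) (∼-sym bc) (∼-sym ab) (∼-sym ra) (λ r≡b → r∉ (here r≡b)) (cycle-≢ C ∘ sym)
        lose : ∀ {I} → Stable I → x ∈ I → All (_∈ I) (r ∷ a ∷ []) → count I (verts (c5 a b c d e)) < 2
        lose {I} st x∈I (r∈I ∷ a∈I ∷ [])
          rewrite ind-∈ a∈I | ind-∉ (nbr-∉ st ab a∈I) | ind-∉ (nbr-∉ st (∼-sym cr) r∈I)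
            | ind-∉ (nbr-∉ st xd x∈I) | ind-∉ (nbr-∉ st (∼-sym ea) a∈I) = ≤-refl
      good-or-loss (a∈ ∷ b∈ ∷ c∈ ∷ d∈ ∷ e∈ ∷ []) (good-c5 C@(cycle ab bc cd de ea) _ _ _)
        (bad-b {a} {b} {c} {d} {e} {r} xb r∈S ar r∉) =
        -- Here `d` excludes `c` and `e`, while `x` and `r` exclude `b` and `a`.
        inj₂ (loss (r ∷ d ∷ []) (r∈S ∷ S-x⊆S d∈ ∷ []) ((x≁r ∷ x≁d ∷ []) ∷ (r≁d ∷ []) ∷ [] ∷ []) lose)
        where
        x≁r : x ≁ r
        x≁r xr = square xb (∼-sym ab) ar (∼-sym xr) (apart a∈) (λ b≡r → r∉ (here (sym b≡r)))
        x≁d : x ≁ d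
        x≁d xd = square xb bc cd (∼-sym xd) (apart c∈) (cycle-≢ (rotate C))
        r≁d : r ≁ d
        r≁d rd = square (∼-sym ar) (∼-sym ea) (∼-sym de) (∼-sym rd) (λ r≡e → r∉ (there (here r≡e)))
          (cycle-≢ (rotate (rotate (rotate C))) ∘ sym)
        lose : ∀ {I} → Stable I → x ∈ I → All (_∈ I) (r ∷ d ∷ []) → count I (verts (c5 a b c d e)) < 2
        lose {I} st x∈I (r∈I ∷ d∈I ∷ [])
          rewrite ind-∈ d∈I | ind-∉ (nbr-∉ st (∼-sym ar) r∈I) | ind-∉ (nbr-∉ st xb x∈I)
            | ind-∉ (nbr-∉ st (∼-sym cd) d∈I) | ind-∉ (nbr-∉ st de d∈I) = ≤-refl

      -- Counting maximal independent sets through a vertex x with a neighbour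

      module _ (x∈S : x ∈ S) (D : Decomposition (S - x)) (statuses : All Status (parts D))
        (wc : WellCovered G S) {y : Fin n} (y∈S : y ∈ S) (xy : x ∼ y) where

        Ps : List Part
        Ps = parts D

        in-S-x : ∀ {P} → P ∈ˡ Ps → All (_∈ S - x) (verts P)
        in-S-x = parts-in D

        in-S : ∀ {P v} → P ∈ˡ Ps → v ∈ˡ verts P → v ∈ S
        in-S i k = S-x⊆S (All.lookup (in-S-x i) k)

        -- A maximal independent set through y avoids x, so it is also maximal in S - x
        -- and has size weights Ps.
        size : ∀ {I} → Mis S I → x ∈ I → suc (count I (vertices Ps)) ≡ weights Ps
        size {I} M x∈I with extend (y ∷ []) (y∈S ∷ []) ([] ∷ [])
        ... | J , MJ , y∈J ∷ [] =
          trans (sym ∣I∣≡) (trans (wc I J (Mis⇒Maximal M) (Mis⇒Maximal MJ)) (mis-size D MJ′))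
          where
          x∉J : x ∉ J
          x∉J = nbr-∉ (stable MJ) (∼-sym xy) y∈J
          MJ′ : Mis (S - x) J
          MJ′ = mis (λ v∈J → x∈p∧x≢y⇒x∈p-y (sub MJ v∈J) λ { refl → x∉J v∈J }) (stable MJ) (dom MJ ∘ S-x⊆S)
          cov : ∀ {v} → v ∈ I → v ∈ˡ x ∷ vertices Ps
          cov {v} v∈I with v ≟ x
          ... | yes v≡x = here v≡x
          ... | no v≢x = there (cover D (x∈p∧x≢y⇒x∈p-y (sub M v∈I) v≢x))
          ∣I∣≡ : ∣ I ∣ ≡ suc (count I (vertices Ps))
          ∣I∣≡ = trans
            (∣I∣≡count (x ∷ vertices Ps) (All.tabulate (λ k → apart (sound D k)) ∷ unique D) cov)
            (cong (_+ count I (vertices Ps)) (ind-∈ x∈I))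

        not-full : ∀ {I} → Mis S I → x ∈ I → ¬ All (λ P → weight P ≤ count I (verts P)) Ps
        not-full {I} M x∈I full =
          <-irrefl refl (≤-trans (≤-reflexive (size M x∈I)) (weights≤counts Ps full))

        -- A maximal independent set through `x` and `T` misses exactly one vertex of the total
        -- weight by `size`. The parts in `Bs` cannot exceed their weights, so those in `As` cannot
        -- miss two.
        not-two-losses : ∀ As {Bs} → Ps ↭ As ++ Bs → ∀ T → All (_∈ S) T → AllPairs _≁_ (x ∷ T) →
          ¬ (∀ {I} → Stable I → x ∈ I → All (_∈ I) T → 2 + count I (vertices As) ≤ weights As)
        not-two-losses As {Bs} σ T T⊆S st lose with extend (x ∷ T) (x∈S ∷ T⊆S) st
        ... | I , M , x∈I ∷ T⊆I = <-irrefl (size M x∈I) (begin-strict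
            suc (count I (vertices Ps))                         ≡⟨ cong suc count-split ⟩
            suc (count I (vertices As) + count I (vertices Bs)) <⟨ +-mono-≤ (lose (stable M) x∈I T⊆I) bound ⟩
            weights As + weights Bs                             ≡⟨ weights-split ⟨
            weights Ps                                          ∎)
          where
          open ≤-Reasoning
          count-split : count I (vertices Ps) ≡ count I (vertices As) + count I (vertices Bs)
          count-split = trans (count-↭ I (vertices-↭ σ))
            (trans (cong (count I) (concatMap-++ verts As Bs)) (count-++ I (vertices As) (vertices Bs)))
          weights-split : weights Ps ≡ weights As + weights Bs
          weights-split = trans (sum-↭ (map⁺ weight σ))
            (trans (cong sum (map-++ weight As Bs)) (sum-++ (map weight As) (map weight Bs)))
          bound : count I (vertices Bs) ≤ weights Bs
          bound = counts≤weights Bs (All.++⁻ʳ As (All-resp-↭ σ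
            (All.map (λ g → count≤weight g (stable M)) (good D))))

        loss-∷ : ∀ {I} P As k → count I (verts P) < weight P → k + count I (vertices As) ≤ weights As →
          suc k + count I (vertices (P ∷ As)) ≤ weights (P ∷ As)
        loss-∷ {I} P As k l m = begin
          suc k + count I (vertices (P ∷ As))                   ≡⟨ cong (suc k +_) (count-++ I (verts P) (vertices As)) ⟩
          suc k + (count I (verts P) + count I (vertices As))   ≡⟨ cong suc (sym (+-assoc k _ _)) ⟩
          suc (k + count I (verts P) + count I (vertices As))   ≡⟨ cong (λ m → suc (m + count I (vertices As))) (+-comm k _) ⟩
          suc (count I (verts P) + k + count I (vertices As))   ≡⟨ cong suc (+-assoc (count I (verts P)) k _) ⟩
          suc (count I (verts P)) + (k + count I (vertices As)) ≤⟨ +-mono-≤ l m ⟩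
          weights (P ∷ As)                                      ∎
          where open ≤-Reasoning

        -- The parts in `As` already account for the single vertex missed by sets through `x`; a
        -- part of `Bs` that is not good would supply a second loss.
        rest-good : ∀ As {Bs} → Ps ↭ As ++ Bs →
          (∀ {I} → Stable I → x ∈ I → 1 + count I (vertices As) ≤ weights As) → All (Good S) Bs
        rest-good As {Bs} σ loseAs = All.tabulate good-in-S
          where
          good-in-S : ∀ {P} → P ∈ˡ Bs → Good S P
          good-in-S {P} j with good-or-loss (in-S-x i) (All.lookup (good D) i) (All.lookup statuses i)
            where i = ∈-resp-↭ (↭-sym σ) (∈-++⁺ʳ As j)
          ... | inj₁ g = g
          ... | inj₂ (loss T T⊆S st lose) with extract j
          ...   | Rs , τ = ⊥-elim (not-two-losses (P ∷ As)
            (↭-trans σ (↭-trans (++⁺ˡ As τ) (shift P As Rs))) T T⊆S st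
            (λ sI x∈I T⊆I → loss-∷ P As 1 (lose sI x∈I T⊆I) (loseAs sI x∈I)))

        -- The two ways of attaching x to old parts

        insert : ∀ Qs → vertices Qs ↭ x ∷ vertices Ps → All (Good S) Qs → Decomposition S
        insert = insert-decomposition x∈S D

        good-of : ∀ {P} → P ∈ˡ Ps → Good (S - x) P
        good-of = All.lookup (good D)

        -- In `S` the only neighbour of `z` is `x`, so `z` is the leaf of a new pendant edge. Every
        -- stable set through `x` loses `z`, which keeps all other parts good.
        attach-isolated : ∀ {z} → k1 z ∈ˡ Ps → x ∼ z → Decomposition S
        attach-isolated {z} i xz with extract i | good-of i
        ... | Rs , σ | good-k1 N = insert (k2 z x ∷ Rs)
          (↭-trans (swap z x refl) (prep x (↭-sym (vertices-↭ σ))))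
          (good-k2 (∼-sym xz) (nbrs-grow N) ∷ rest-good (k1 z ∷ []) σ lose)
          where
          lose : ∀ {I} → Stable I → x ∈ I → 1 + count I (z ∷ []) ≤ 1
          lose {I} st x∈I rewrite ind-∉ (nbr-∉ st xz x∈I) = ≤-refl

        -- The new 5-cycle is `x p q q′ p′`. Stable sets through `x` retain at most one end of `qq′`
        -- from the two edges, so the other parts stay good. The open vertices are `x` and one of
        -- `q`, `q′`: if both had outside neighbours, selecting these would empty both edges, a
        -- double loss.
        close-cycle : ∀ {p q p′ q′} → k2 p q ≢ k2 p′ q′ → k2 p q ∈ˡ Ps → k2 p′ q′ ∈ˡ Ps →
          x ∼ p → x ∼ p′ → q ∼ q′ → Decomposition S
        close-cycle {p} {q} {p′} {q′} P≢P′ i i′ xp xp′ qq′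
          with extract₂ P≢P′ i i′ | good-of i | good-of i′ | in-S-x i | in-S-x i′
        ... | Rs , σ | good-k2 pq Np | good-k2 p′q′ Np′ | p∈ ∷ q∈ ∷ [] | p′∈ ∷ q′∈ ∷ [] =
          go (outer? q (p ∷ q′ ∷ [])) (outer? q′ (q ∷ p′ ∷ []))
          where
          As = k2 p q ∷ k2 p′ q′ ∷ []
          lose : ∀ {I} → Stable I → x ∈ I → 1 + count I (vertices As) ≤ 2
          lose {I} st x∈I
            rewrite ind-∉ (nbr-∉ st xp x∈I) | ind-∉ (nbr-∉ st xp′ x∈I) | +-identityʳ (ind I q′) =
              s≤s (edge-count st qq′)
          rest : All (Good S) Rs
          rest = rest-good As σ lose
          back : x ∷ p ∷ q ∷ p′ ∷ q′ ∷ vertices Rs ↭ x ∷ vertices Ps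
          back = prep x (↭-sym (vertices-↭ σ))
          go : (∃ λ r → r ∈ S × q ∼ r × r ∉ˡ p ∷ q′ ∷ []) ⊎ NbrsIn S q (p ∷ q′ ∷ []) →
            (∃ λ r → r ∈ S × q′ ∼ r × r ∉ˡ q ∷ p′ ∷ []) ⊎ NbrsIn S q′ (q ∷ p′ ∷ []) → Decomposition S
          go _ (inj₂ Nq′) = insert (c5 x p q q′ p′ ∷ Rs)
            (↭-trans (prep x (prep p (prep q (swap q′ p′ refl)))) back)
            (good-c5 (cycle xp pq qq′ (∼-sym p′q′) (∼-sym xp′))
              (nbrs-grow Np) Nq′ (swap-nbrs (nbrs-grow Np′)) ∷ rest)
          go (inj₂ Nq) _ = insert (c5 x p′ q′ q p ∷ Rs)
            (↭-trans (prep x (↭-trans (shifts (p′ ∷ q′ ∷ []) (q ∷ p ∷ [])) (swap q p refl))) back)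
            (good-c5 (cycle xp′ p′q′ (∼-sym qq′) (∼-sym pq) (∼-sym xp))
              (nbrs-grow Np′) (swap-nbrs Nq) (swap-nbrs (nbrs-grow Np)) ∷ rest)
          go (inj₁ (r , r∈S , qr , r∉)) (inj₁ (r′ , r′∈S , q′r′ , r′∉)) =
            ⊥-elim (not-two-losses As σ (r ∷ r′ ∷ []) (r∈S ∷ r′∈S ∷ [])
              ((x≁r ∷ x≁r′ ∷ []) ∷ (r≁r′ ∷ []) ∷ [] ∷ []) lose₂)
            where
            x≁r : x ≁ r
            x≁r xr = square xp pq qr (∼-sym xr) (apart q∈) (λ p≡r → r∉ (here (sym p≡r)))
            x≁r′ : x ≁ r′
            x≁r′ xr′ = square xp′ p′q′ q′r′ (∼-sym xr′) (apart q′∈) (λ p′≡r′ → r′∉ (there (here (sym p′≡r′))))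
            r≁r′ : r ≁ r′
            r≁r′ rr′ = square (∼-sym qr) qq′ q′r′ (∼-sym rr′)
              (λ r≡q′ → r∉ (there (here r≡q′))) (λ q≡r′ → r′∉ (here (sym q≡r′)))
            lose₂ : ∀ {I} → Stable I → x ∈ I → All (_∈ I) (r ∷ r′ ∷ []) → 2 + count I (vertices As) ≤ 2
            lose₂ {I} st x∈I (r∈I ∷ r′∈I ∷ [])
              rewrite ind-∉ (nbr-∉ st xp x∈I) | ind-∉ (nbr-∉ st xp′ x∈I)
                | ind-∉ (nbr-∉ st (∼-sym qr) r∈I) | ind-∉ (nbr-∉ st (∼-sym q′r′) r′∈I) = ≤-refl

        -- A vertex t of a part adjacent to x whose selection makes the part full.  If
        -- instead t is dominated, selecting d makes the part lose a vertex; d has no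
        -- neighbour outside the part (d = x when no such vertex is needed).
        record Choice : Set where
          constructor choice
          field
            {part} : Part
            part∈ : part ∈ˡ Ps
            {t} : Fin n
            t∈ : t ∈ˡ verts part
            x≁t : x ≁ t
            full : ∀ {I} → Mis S I → x ∈ I → t ∈ I → weight part ≤ count I (verts part)
            {d} : Fin n
            d-home : d ≡ x ⊎ d ∈ˡ verts part
            x≁d : x ≁ d
            d-local : ∀ {u} → u ∈ S → u ∉ˡ verts part → x ≁ u → d ≁ u
            breaks : ∀ {I} → Stable I → x ∈ I → d ∈ I → t ∉ I → count I (verts part) < weight part

        open Choice

        d∈S : ∀ C → d C ∈ S
        d∈S C with d-home C
        ... | inj₁ refl = x∈S
        ... | inj₂ k = in-S (part∈ C) k

        -- As `x` excludes the leaf `p`, the edge can be filled only by `q`. Once `q` is dominated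
        -- the edge is empty, so `x` itself serves as `d`.
        choose-k2 : ∀ {p q} → k2 p q ∈ˡ Ps → p ∼ q → x ∼ p → Choice
        choose-k2 {p} {q} i pq xp = choice i at1 (no-chord xp pq)
          (λ {I} M x∈I q∈I → 1≤count {xs = p ∷ q ∷ []} at1 q∈I) (inj₁ refl) ∼-irrefl (λ _ _ x≁u → x≁u) lose
          where
          lose : ∀ {I} → Stable I → x ∈ I → x ∈ I → q ∉ I → count I (verts (k2 p q)) < 1
          lose {I} st x∈I _ q∉I rewrite ind-∉ (nbr-∉ st xp x∈I) | ind-∉ q∉I = s≤s z≤n

        module _ {a b c d e : Fin n} (i : c5 a b c d e ∈ˡ Ps) where

          local : ∀ {v w z} → NbrsIn S v (w ∷ z ∷ []) → w ∈ˡ verts (c5 a b c d e) →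
            z ∈ˡ verts (c5 a b c d e) → ∀ {u} → u ∈ S → u ∉ˡ verts (c5 a b c d e) → x ≁ u → v ≁ u
          local N w∈ z∈ u∈S u∉ _ v∼u with N u∈S v∼u
          ... | at0 = u∉ w∈
          ... | at1 = u∉ z∈

          both : ∀ {I v w} → v ≢ w → v ∈ˡ verts (c5 a b c d e) → w ∈ˡ verts (c5 a b c d e) →
            v ∈ I → w ∈ I → 2 ≤ count I (verts (c5 a b c d e))
          both = 2≤count

          -- With `e` selected, `b` forces `b` or `c` as the second vertex. With `e` dominated,
          -- selecting `b` excludes `a` and `c`, and `x` excludes `d`.
          choose-e : Good (S - x) (c5 a b c d e) → All (_∈ S - x) (verts (c5 a b c d e)) → x ∼ d → Choice
          choose-e (good-c5 C@(cycle ab bc cd de ea) Nb Nd Ne) (a∈ ∷ b∈ ∷ c∈ ∷ d∈ ∷ e∈ ∷ []) xd =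
            choice i at4 (no-chord xd de) full-e (inj₂ at1) x≁b (local Nb′ at0 at2) lose
            where
            x≁b : x ≁ b
            x≁b xb = square xd (∼-sym cd) (∼-sym bc) (∼-sym xb) (apart c∈) (cycle-≢ (rotate C) ∘ sym)
            Nb′ : NbrsIn S b (a ∷ c ∷ [])
            Nb′ = nbrs-lift Nb x≁b
            full-e : ∀ {I} → Mis S I → x ∈ I → e ∈ I → 2 ≤ count I (verts (c5 a b c d e))
            full-e M _ e∈I with settle M (S-x⊆S b∈) (swap-nbrs Nb′) (nbr-∉ (stable M) ea e∈I)
            ... | inj₁ b∈I = both (cycle-≢ (rotate (rotate (rotate (rotate C)))) ∘ sym) at1 at4 b∈I e∈I
            ... | inj₂ c∈I = both (cycle-≢ (rotate (rotate C))) at2 at4 c∈I e∈I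
            lose : ∀ {I} → Stable I → x ∈ I → b ∈ I → e ∉ I → count I (verts (c5 a b c d e)) < 2
            lose {I} st x∈I b∈I e∉I
              rewrite ind-∈ b∈I | ind-∉ (nbr-∉ st (∼-sym ab) b∈I) | ind-∉ (nbr-∉ st bc b∈I)
                | ind-∉ (nbr-∉ st xd x∈I) | ind-∉ e∉I = ≤-refl

          -- Here `d` forces the second vertex, and selecting `d` breaks the part when `a` is
          -- dominated. `choose-c` is the mirror image, kept as an alternative in case `a` is
          -- adjacent to a vertex chosen earlier.
          choose-a : Good (S - x) (c5 a b c d e) → All (_∈ S - x) (verts (c5 a b c d e)) → x ∼ b → Choice
          choose-a (good-c5 C@(cycle ab bc cd de ea) Nb Nd Ne) (a∈ ∷ b∈ ∷ c∈ ∷ d∈ ∷ e∈ ∷ []) xb =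
            choice i at0 (no-chord xb (∼-sym ab)) full-a (inj₂ at3) x≁d′ (local Nd′ at2 at4) lose
            where
            x≁d′ : x ≁ d
            x≁d′ xd = square xb bc cd (∼-sym xd) (apart c∈) (cycle-≢ (rotate C))
            Nd′ : NbrsIn S d (c ∷ e ∷ [])
            Nd′ = nbrs-lift Nd x≁d′
            full-a : ∀ {I} → Mis S I → x ∈ I → a ∈ I → 2 ≤ count I (verts (c5 a b c d e))
            full-a M _ a∈I with settle M (S-x⊆S d∈) Nd′ (nbr-∉ (stable M) (∼-sym ea) a∈I)
            ... | inj₁ d∈I = both (cycle-≢ (rotate (rotate (rotate C))) ∘ sym) at0 at3 a∈I d∈I
            ... | inj₂ c∈I = both (cycle-≢ C) at0 at2 a∈I c∈I
            lose : ∀ {I} → Stable I → x ∈ I → d ∈ I → a ∉ I → count I (verts (c5 a b c d e)) < 2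
            lose {I} st x∈I d∈I a∉I
              rewrite ind-∈ d∈I | ind-∉ a∉I | ind-∉ (nbr-∉ st xb x∈I)
                | ind-∉ (nbr-∉ st (∼-sym cd) d∈I) | ind-∉ (nbr-∉ st de d∈I) = ≤-refl

          choose-c : Good (S - x) (c5 a b c d e) → All (_∈ S - x) (verts (c5 a b c d e)) → x ∼ b → Choice
          choose-c (good-c5 C@(cycle ab bc cd de ea) Nb Nd Ne) (a∈ ∷ b∈ ∷ c∈ ∷ d∈ ∷ e∈ ∷ []) xb =
            choice i at2 (no-chord xb bc) full-c (inj₂ at4) x≁e (local Ne′ at3 at0) lose
            where
            x≁e : x ≁ e
            x≁e xe = square xb (∼-sym ab) (∼-sym ea) (∼-sym xe) (apart a∈)
              (cycle-≢ (rotate (rotate (rotate (rotate C)))) ∘ sym)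
            Ne′ : NbrsIn S e (d ∷ a ∷ [])
            Ne′ = nbrs-lift Ne x≁e
            full-c : ∀ {I} → Mis S I → x ∈ I → c ∈ I → 2 ≤ count I (verts (c5 a b c d e))
            full-c M _ c∈I with settle M (S-x⊆S e∈) (swap-nbrs Ne′) (nbr-∉ (stable M) cd c∈I)
            ... | inj₁ e∈I = both (cycle-≢ (rotate (rotate C))) at2 at4 c∈I e∈I
            ... | inj₂ a∈I = both (cycle-≢ C) at0 at2 a∈I c∈I
            lose : ∀ {I} → Stable I → x ∈ I → e ∈ I → c ∉ I → count I (verts (c5 a b c d e)) < 2
            lose {I} st x∈I e∈I c∉I
              rewrite ind-∈ e∈I | ind-∉ c∉I | ind-∉ (nbr-∉ st xb x∈I)
                | ind-∉ (nbr-∉ st ea e∈I) | ind-∉ (nbr-∉ st (∼-sym de) e∈I) = ≤-refl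

        -- Collecting pairwise compatible choices

        Compatible : Choice → Choice → Set
        Compatible C C′ = part C ≢ part C′ × t C ≁ t C′

        Covered : List Choice → Part → Set
        Covered T P = ∃ λ C → C ∈ˡ T × part C ≡ P

        covered-or-fresh : ∀ {P} T → P ∈ˡ Ps → Covered T P ⊎ All (λ C → t C ∉ˡ verts P) T
        covered-or-fresh {P} T i with Any.any? (λ C → t C ∈ˡ? verts P) T
        ... | no ¬p = inj₂ (All.¬Any⇒All¬ T ¬p)
        ... | yes p with find p
        ...   | C , C∈T , t∈P = inj₁ (C , C∈T , same-part (unique D) (part∈ C) i (t∈ C) t∈P)

        conflict? : ∀ v T → (∃ λ C → C ∈ˡ T × v ∼ t C) ⊎ All (λ C → v ≁ t C) T
        conflict? v T with Any.any? (λ C → v ∼? t C) T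
        ... | yes p = inj₁ (find p)
        ... | no ¬p = inj₂ (All.¬Any⇒All¬ T ¬p)

        add-choice : ∀ C {T} → AllPairs Compatible T → All (λ C′ → t C′ ∉ˡ verts (part C)) T →
          All (λ C′ → t C ≁ t C′) T → AllPairs Compatible (C ∷ T)
        add-choice C ps fresh free = All.zipWith (λ {C′} → compatible {C′}) (fresh , free) ∷ ps
          where
          compatible : ∀ {C′} → t C′ ∉ˡ verts (part C) × t C ≁ t C′ → Compatible C C′
          compatible {C′} (t∉ , ≁t) = (λ eq → t∉ (subst (λ P → t C′ ∈ˡ verts P) (sym eq) (t∈ C′))) , ≁t

        later : ∀ {C T P} → Covered T P → Covered (C ∷ T) P
        later (C , j , eq) = C , there j , eq

        -- Remembers the leaf next to `x`, so that a conflict between two such choices yields the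
        -- data for `close-cycle`.
        FromK2 : Choice → Set
        FromK2 C = ∃ λ p → part C ≡ k2 p (t C) × x ∼ p

        -- An isolated vertex adjacent to `x`, or two adjacent choices, leads at once to a
        -- decomposition of `S`; otherwise every edge whose leaf is adjacent to `x` receives a
        -- choice.
        choose-k2s : ∀ Qs → (∀ {P} → P ∈ˡ Qs → P ∈ˡ Ps) → Decomposition S ⊎
          ∃ λ T → AllPairs Compatible T × All FromK2 T × (∀ {z} → k1 z ∈ˡ Qs → x ≁ z) ×
            (∀ {p q} → k2 p q ∈ˡ Qs → x ∼ p → Covered T (k2 p q))
        choose-k2s [] _ = inj₂ ([] , [] , [] , (λ ()) , (λ ()))
        choose-k2s (Q ∷ Qs) ⊆Ps with choose-k2s Qs (⊆Ps ∘ there)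
        ... | inj₁ E = inj₁ E
        ... | inj₂ (T , ps , fs , isolated , cov) = step Q (⊆Ps at0)
          where
          Result : Part → Set
          Result Q = Decomposition S ⊎
            ∃ λ T → AllPairs Compatible T × All FromK2 T × (∀ {z} → k1 z ∈ˡ Q ∷ Qs → x ≁ z) ×
              (∀ {p q} → k2 p q ∈ˡ Q ∷ Qs → x ∼ p → Covered T (k2 p q))
          step : ∀ Q → Q ∈ˡ Ps → Result Q
          step (k1 z) i with x ∼? z
          ... | yes xz = inj₁ (attach-isolated i xz)
          ... | no x≁z = inj₂ (T , ps , fs , (λ { at0 → x≁z ; (there j) → isolated j }) , λ { (there j) → cov j })
          step (c5 _ _ _ _ _) i =
            inj₂ (T , ps , fs , (λ { (there j) → isolated j }) , λ { (there j) → cov j })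
          step (k2 p q) i with x ∼? p
          ... | no x≁p = inj₂ (T , ps , fs , (λ { (there j) → isolated j }) ,
            λ { at0 xp → ⊥-elim (x≁p xp) ; (there j) → cov j })
          ... | yes xp with covered-or-fresh T i | conflict? q T | good-of i
          ...   | inj₁ known | _ | _ = inj₂ (T , ps , fs , (λ { (there j) → isolated j }) ,
            λ { at0 _ → known ; (there j) → cov j })
          ...   | inj₂ fresh | inj₂ free | good-k2 pq _ = inj₂
            (choose-k2 i pq xp ∷ T , add-choice (choose-k2 i pq xp) ps fresh free ,
             (p , refl , xp) ∷ fs , (λ { (there j) → isolated j }) ,
             λ { at0 _ → _ , at0 , refl ; (there j) xp′ → later (cov j xp′) })
          ...   | inj₂ fresh | inj₁ (C , C∈T , qt) | _ with All.lookup fs C∈T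
          ...     | p′ , eq , xp′ =
            inj₁ (close-cycle P≢P′ i (subst (_∈ˡ Ps) eq (part∈ C)) xp xp′ qt)
            where
            P≢P′ : k2 p q ≢ k2 p′ (t C)
            P≢P′ P≡P′ = All.lookup fresh C∈T
              (subst (λ P → t C ∈ˡ verts P) (trans eq (sym P≡P′)) (t∈ C))

        -- If both a and c are blocked, select them and break the two blocking parts.
        unblocked : ∀ {a b c d e T} → c5 a b c d e ∈ˡ Ps → Cycle a b c d e → x ∼ b →
          AllPairs Compatible T → All (λ C → t C ∉ˡ verts (c5 a b c d e)) T →
          ∀ {C₁ C₂} → C₁ ∈ˡ T → C₂ ∈ˡ T → a ∼ t C₁ → c ∼ t C₂ → Empty.⊥
        unblocked {a} {b} {c} {d} {e} {T} i cyc@(cycle ab bc cd de ea) xb ps fresh {C₁} {C₂} i₁ i₂ at₁ ct₂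
          with AllPairs-∈ ps i₁ i₂
        -- A single blocker of both `a` and `c` would close a 4-cycle through `b`.
        ... | inj₁ refl = square ab bc ct₂ (∼-sym at₁) (cycle-≢ cyc)
          (λ { refl → All.lookup fresh i₁ at1 })
        ... | inj₂ compat with extract₂ P₁≢P₂ (part∈ C₁) (part∈ C₂)
          where
          P₁≢P₂ : part C₁ ≢ part C₂
          P₁≢P₂ eq = [ (λ p → proj₁ p eq) , (λ p → proj₁ p (sym eq)) ] compat
        ...   | Rs , σ = not-two-losses (part C₁ ∷ part C₂ ∷ []) σ (a ∷ c ∷ Choice.d C₁ ∷ Choice.d C₂ ∷ [])
          (in-S i at0 ∷ in-S i at2 ∷ d∈S C₁ ∷ d∈S C₂ ∷ [])
          ((x≁a ∷ x≁c ∷ x≁d C₁ ∷ x≁d C₂ ∷ []) ∷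
           (no-chord ab bc ∷ away C₁ i₁ at0 x≁a ∷ away C₂ i₂ at0 x≁a ∷ []) ∷
           (away C₁ i₁ at2 x≁c ∷ away C₂ i₂ at2 x≁c ∷ []) ∷ (d₁≁d₂ ∷ []) ∷ [] ∷ [])
          lose
          where
          x≁a : x ≁ a
          x≁a = no-chord xb (∼-sym ab)
          x≁c : x ≁ c
          x≁c = no-chord xb bc
          away : ∀ C → C ∈ˡ T → ∀ {u} → u ∈ˡ verts (c5 a b c d e) → x ≁ u → u ≁ Choice.d C
          away C j {u} u∈ x≁u = d-local C (in-S i u∈) u∉ x≁u ∘ ∼-sym
            where
            u∉ : u ∉ˡ verts (part C)
            u∉ k = All.lookup fresh j
              (subst (λ P → t C ∈ˡ verts P) (same-part (unique D) (part∈ C) i k u∈) (t∈ C))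
          d₂∉ : Choice.d C₂ ∉ˡ verts (part C₁)
          d₂∉ k with d-home C₂
          ... | inj₁ eq = apart (All.lookup (in-S-x (part∈ C₁)) k) (sym eq)
          ... | inj₂ l = [ (λ p → proj₁ p eq) , (λ p → proj₁ p (sym eq)) ] compat
            where
            eq : part C₁ ≡ part C₂
            eq = same-part (unique D) (part∈ C₁) (part∈ C₂) k l
          d₁≁d₂ : Choice.d C₁ ≁ Choice.d C₂
          d₁≁d₂ = d-local C₁ (d∈S C₂) d₂∉ (x≁d C₂)
          lose : ∀ {I} → Stable I → x ∈ I → All (_∈ I) (a ∷ c ∷ Choice.d C₁ ∷ Choice.d C₂ ∷ []) →
            2 + count I (vertices (part C₁ ∷ part C₂ ∷ [])) ≤ weights (part C₁ ∷ part C₂ ∷ [])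
          lose st x∈I (a∈I ∷ c∈I ∷ d₁∈I ∷ d₂∈I ∷ []) =
            loss-∷ (part C₁) (part C₂ ∷ []) 1 (breaks C₁ st x∈I d₁∈I (nbr-∉ st at₁ a∈I))
              (loss-∷ (part C₂) [] 0 (breaks C₂ st x∈I d₂∈I (nbr-∉ st ct₂ c∈I)) z≤n)

        -- If `x` meets `d`, the choice `e` has prescribed neighbours and cannot conflict with the
        -- others. If `x` meets `b`, one of `a` and `c` is free by `unblocked`.
        choose-c5s : ∀ {T} → AllPairs Compatible T → ∀ Qs → (∀ {P} → P ∈ˡ Qs → P ∈ˡ Ps) →
          ∃ λ T′ → AllPairs Compatible T′ × (∀ {C} → C ∈ˡ T → C ∈ˡ T′) ×
            (∀ {a b c d e} → c5 a b c d e ∈ˡ Qs → Good S (c5 a b c d e) ⊎ Covered T′ (c5 a b c d e))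
        choose-c5s {T} ps [] _ = T , ps , (λ m → m) , λ ()
        choose-c5s {T} ps₀ (Q ∷ Qs) ⊆Ps with choose-c5s ps₀ Qs (⊆Ps ∘ there)
        ... | T′ , ps , T⊆T′ , cov = step Q (⊆Ps at0)
          where
          Result : Part → Set
          Result Q = ∃ λ T″ → AllPairs Compatible T″ × (∀ {C} → C ∈ˡ T → C ∈ˡ T″) ×
            (∀ {a b c d e} → c5 a b c d e ∈ˡ Q ∷ Qs → Good S (c5 a b c d e) ⊎ Covered T″ (c5 a b c d e))
          more : ∀ C → All (λ C′ → t C′ ∉ˡ verts (part C)) T′ → All (λ C′ → t C ≁ t C′) T′ → Result (part C)
          more C fresh free = C ∷ T′ , add-choice C ps fresh free , there ∘ T⊆T′ ,
            λ { at0 → inj₂ (C , at0 , refl)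
              ; (there j) → [ inj₁ , inj₂ ∘ later ] (cov j) }
          step : ∀ Q → Q ∈ˡ Ps → Result Q
          step (k1 _) _ = T′ , ps , T⊆T′ , λ { (there j) → cov j }
          step (k2 _ _) _ = T′ , ps , T⊆T′ , λ { (there j) → cov j }
          step (c5 a b c d e) i with covered-or-fresh T′ i
          ... | inj₁ known = T′ , ps , T⊆T′ , λ { at0 → inj₂ known ; (there j) → cov j }
          ... | inj₂ fresh with All.lookup statuses i | good-of i | in-S-x i
          ...   | ok g | _ | _ = T′ , ps , T⊆T′ , λ { at0 → inj₁ g ; (there j) → cov j }
          ...   | bad-d xd _ _ _ | g@(good-c5 (cycle _ _ _ de _) _ _ Ne) | h@(_ ∷ _ ∷ _ ∷ _ ∷ _ ∷ []) =
            more (choose-e i g h xd) fresh (All.tabulate λ {C} j → e≁ C (All.lookup fresh j))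
            where
            e≁ : ∀ C → t C ∉ˡ verts (c5 a b c d e) → e ≁ t C
            e≁ C t∉ = local i (nbrs-lift Ne (no-chord xd de)) at3 at0 (in-S (part∈ C) (t∈ C)) t∉ (x≁t C)
          ...   | bad-b xb _ _ _ | g@(good-c5 cyc@(cycle _ _ _ _ _) _ _ _) | h@(_ ∷ _ ∷ _ ∷ _ ∷ _ ∷ [])
            with conflict? a T′ | conflict? c T′
          ...     | inj₂ free | _ = more (choose-a i g h xb) fresh free
          ...     | inj₁ _ | inj₂ free = more (choose-c i g h xb) fresh free
          ...     | inj₁ (C₁ , i₁ , at₁) | inj₁ (C₂ , i₂ , ct₂) =
            ⊥-elim (unblocked i cyc xb ps fresh i₁ i₂ at₁ ct₂)

        -- When no attachment occurs, a maximal independent set through `x` and all chosen vertices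
        -- fills every part: parts with a choice by `full`, the others because they are good in `S`.
        -- This contradicts `not-full`.
        insert-vertex : Decomposition S
        insert-vertex with choose-k2s Ps (λ i → i)
        ... | inj₁ E = E
        ... | inj₂ (T , ps , _ , isolated , cov₂) with choose-c5s ps Ps (λ i → i)
        ...   | T′ , ps′ , T⊆T′ , cov₅ with extend (x ∷ map t T′)
            (x∈S ∷ All.map⁺ (All.tabulate λ {C} _ → in-S (part∈ C) (t∈ C)))
            (All.map⁺ (All.tabulate λ {C} _ → x≁t C) ∷ AllPairs.map⁺ (AllPairs.map proj₂ ps′))
        ...     | I , M , x∈I ∷ T′⊆I = ⊥-elim (not-full M x∈I (All.tabulate (λ {P} i → full-part P i)))
          where
          covered-full : ∀ {P} → Covered T′ P → weight P ≤ count I (verts P)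
          covered-full (C , j , refl) = full C M x∈I (All.lookup T′⊆I (∈-map⁺ t j))
          good-full : ∀ {P} → P ∈ˡ Ps → Good S P → weight P ≤ count I (verts P)
          good-full i g = weight≤count g (All.map S-x⊆S (in-S-x i)) M
          full-part : ∀ P → P ∈ˡ Ps → weight P ≤ count I (verts P)
          full-part (k1 z) i with good-of i
          ... | good-k1 N = good-full i (good-k1 (nbrs-lift N (isolated i)))
          full-part (k2 p q) i with good-of i | x ∼? p
          ... | good-k2 pq N | no x≁p = good-full i (good-k2 pq (nbrs-lift N x≁p))
          ... | good-k2 pq N | yes xp with cov₂ i xp
          ...   | C , j , eq = covered-full (C , T⊆T′ j , eq)
          full-part (c5 a b c d e) i with cov₅ i
          ... | inj₁ g = good-full i g
          ... | inj₂ cv = covered-full cv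

    -- A neighbour `y` of `x` supplies the comparison set used in `size`. A vertex without
    -- neighbours in `S` becomes a part of its own and disturbs no other part.
    add-vertex : ∀ {S x} → x ∈ S → WellCovered G S → Decomposition (S - x) → Decomposition S
    add-vertex {S} {x} x∈S wc D with neighbour? x S
    ... | yes (y , y∈S , xy) with normalise D
    ...   | D′ , statuses = insert-vertex x∈S D′ statuses wc y∈S xy
    add-vertex {S} {x} x∈S wc D | no ¬p = insert-decomposition x∈S D (k1 x ∷ parts D) refl
      (good-k1 (λ w∈S xw → ⊥-elim (¬p (_ , w∈S , xw))) ∷
       All.tabulate (λ i → lift (parts-in D i) (All.lookup (good D) i)))
      where
      x≁ : ∀ {v} → v ∈ S - x → x ≁ v
      x≁ v∈ xv = ¬p (_ , p─q⊆p S ⁅ x ⁆ v∈ , xv)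
      lift : ∀ {P} → All (_∈ S - x) (verts P) → Good (S - x) P → Good S P
      lift (v∈ ∷ []) (good-k1 N) = good-k1 (nbrs-lift N (x≁ v∈))
      lift (p∈ ∷ _) (good-k2 pq N) = good-k2 pq (nbrs-lift N (x≁ p∈))
      lift (_ ∷ b∈ ∷ _ ∷ d∈ ∷ e∈ ∷ []) (good-c5 C Nb Nd Ne) =
        good-c5 C (nbrs-lift Nb (x≁ b∈)) (nbrs-lift Nd (x≁ d∈)) (nbrs-lift Ne (x≁ e∈))

    -- Induction along a vertex decomposition

    edgeless⇒decomposition : ∀ {S} → NoEdges G S → Decomposition S
    edgeless⇒decomposition {S} ne = decomposition (map k1 vs)
      (subst Unique (sym vertices≡) (filter⁺ (_∈? S) (allFin⁺ n)))
      (λ v∈S → subst (_ ∈ˡ_) (sym vertices≡) (∈-filter⁺ (_∈? S) (∈-allFin _) v∈S))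
      (λ k → in-vs (subst (_ ∈ˡ_) vertices≡ k))
      (All.map⁺ (All.tabulate (λ k → good-k1 (λ w∈S vw → ⊥-elim (ne _ _ (in-vs k) w∈S vw)))))
      where
      vs : List (Fin n)
      vs = filter (_∈? S) (allFin n)
      in-vs : ∀ {v} → v ∈ˡ vs → v ∈ S
      in-vs k = proj₂ (∈-filter⁻ (_∈? S) {xs = allFin n} k)
      vertices≡ : vertices (map k1 vs) ≡ vs
      vertices≡ = go vs
        where
        go : ∀ vs → vertices (map k1 vs) ≡ vs
        go [] = refl
        go (v ∷ vs) = cong (v ∷_) (go vs)

    vd⇒decomposition : ∀ {S} → VertexDecomposable G S → Decomposition S
    vd⇒decomposition (vd-edgeless _ ne) = edgeless⇒decomposition ne
    vd⇒decomposition (vd-shed wc x x∈S vd _) = add-vertex x∈S wc (vd⇒decomposition vd)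

theorem5p3 : ∀ {n : ℕ} (G : Graph n) → GirthAtLeast5 G →
    VertexDecomposable G ⊤ → Dominating G ⊤ (Shed G ⊤)
theorem5p3 G g5 vd = shed-dominating G g5 (vd⇒decomposition G g5 vd)
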